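{- Let $n$ and $k$ be positive integers with $n>2k$, and let $j\geqslant 0$ be the integer such that $2^j\leqslant k<2^{j+1}$. Let $Y_k=S_k\times S_{n-k}$ be the subgroup of the symmetric group $S_n$ in which the factor $S_k$ permutes $\{1,\ldots,k\}$ and the factor $S_{n-k}$ permutes $\{k+1,\ldots,n\}$. Let $x\in S_n$ and let $X=x^{S_n}$ be the conjugacy class of $x$ in $S_n$. Then there exists a positive integer $r$ such that $r S_n=X\boldsymbol{\cdot}Y_k$ if and only if the cycle type of $x$ (counting fixed points as cycles of length $1$) has exactly one cycle of length $2^i$ for each $0\leqslant i\leqslant j$, and all other cycles of $x$ have length at least $k+1$.
   Context: For subsets $A,B$ of a finite group $G$ and a positive integer $r$, one writes $rG=A\boldsymbol{\cdot}B$ if for every $g\in G$ there are precisely $r$ pairs $(a,b)\in A\times B$ with $g=ab$ (in which case $B$ is called a code in $G$ with respect to $A$). -}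

module Defs where

open import Data.Nat using (ℕ; zero; suc; _+_; _*_; _^_; _≤_; _<_)
open import Data.Fin using (Fin; toℕ)
open import Data.Fin.Permutation using (Permutation′; _⟨$⟩ʳ_)
open import Data.Product using (Σ; ∃; ∃-syntax; _×_; _,_)
open import Data.Sum using (_⊎_)
open import Relation.Binary.PropositionalEquality using (_≡_; _≢_)
open import Relation.Nullary using (¬_)

-- Elements of the symmetric group S_n: permutations of Fin n = {0,…,n-1}
-- (point i ∈ Fin n stands for the point i+1 ∈ {1,…,n}).
Perm : ℕ → Set
Perm n = Permutation′ n

_≈ₚ_ : ∀ {n} → Perm n → Perm n → Set
π ≈ₚ ρ = ∀ i → π ⟨$⟩ʳ i ≡ ρ ⟨$⟩ʳ i

IsProd : ∀ {n} → Perm n → Perm n → Perm n → Set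
IsProd g a b = ∀ i → g ⟨$⟩ʳ i ≡ a ⟨$⟩ʳ (b ⟨$⟩ʳ i)

_≈²_ : ∀ {n} → Perm n × Perm n → Perm n × Perm n → Set
(a , b) ≈² (a′ , b′) = (a ≈ₚ a′) × (b ≈ₚ b′)

HasCard : {A : Set} → (A → A → Set) → (A → Set) → ℕ → Set
HasCard {A} _≈_ P r =
  Σ (Fin r → A) λ f →
    (∀ t → P (f t)) ×
    (∀ s t → f s ≈ f t → s ≡ t) ×
    (∀ a → P a → ∃[ t ] (a ≈ f t))

IsCode : ∀ {n} → ℕ → (Perm n → Set) → (Perm n → Set) → Set
IsCode {n} r A B =
  ∀ (g : Perm n) → HasCard _≈²_ (λ p → A (Data.Product.proj₁ p) × B (Data.Product.proj₂ p)
                                        × IsProd g (Data.Product.proj₁ p) (Data.Product.proj₂ p)) r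

ConjClass : ∀ {n} → Perm n → Perm n → Set
ConjClass {n} x a = ∃[ h ] (∀ i → a ⟨$⟩ʳ (h ⟨$⟩ʳ i) ≡ h ⟨$⟩ʳ (x ⟨$⟩ʳ i))

Young : ∀ {n} → ℕ → Perm n → Set
Young k b = ∀ i → (toℕ i < k → toℕ (b ⟨$⟩ʳ i) < k) × (¬ (toℕ i < k) → ¬ (toℕ (b ⟨$⟩ʳ i) < k))

iter : ∀ {n} → Perm n → ℕ → Fin n → Fin n
iter x zero i = i
iter x (suc m) i = x ⟨$⟩ʳ (iter x m i)

OrbitLen : ∀ {n} → Perm n → Fin n → ℕ → Set
OrbitLen x i ℓ = (1 ≤ ℓ) × (iter x ℓ i ≡ i) × (∀ m → 1 ≤ m → m < ℓ → iter x m i ≢ i)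

-- i is the least point of its cycle (cycles are counted via this representative).
CycleRep : ∀ {n} → Perm n → Fin n → Set
CycleRep x i = ∀ m → toℕ i ≤ toℕ (iter x m i)

CycleOfLen : ∀ {n} → Perm n → ℕ → Fin n → Set
CycleOfLen x ℓ i = CycleRep x i × OrbitLen x i ℓ

CycleCondition : ∀ {n} → ℕ → ℕ → Perm n → Set
CycleCondition k j x =
  (∀ i → i ≤ j → HasCard _≡_ (CycleOfLen x (2 ^ i)) 1) ×
  (∀ p ℓ → CycleOfLen x ℓ p → (∃[ i ] (i ≤ j × ℓ ≡ 2 ^ i)) ⊎ (suc k ≤ ℓ))

{-# OPTIONS --safe #-}

-- Write entry D E for the number of a ∈ X with a D = E. Since gY_k consists of the permutations mapping
-- {1,…,k} to its image under g, X·Y_k covers S_n exactly r times iff entry D E = r for all k-sets D, E.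
-- As X is a class, entry D E depends only on |D|, |E| and |D ∩ E|. Counting pairs (a , p) with a (D ∪ {p}) = E
-- links |D| = i with |E| = i + 1, and an induction on |D ∩ E| turns this into: if entry is constant
-- on (i+1)-sets, it is constant on i-sets; conversely constancy passes from i-sets to (i+1)-sets as soon as
-- the diagonal entries have the average value. The trace of entry on i-sets is |X| times the number
-- of i-sets fixed by x, so the code condition says that x fixes exactly one i-set for every i ≤ k.
-- A fixed set is a union of cycles, and uniqueness of binary expansions finishes the argument.

module Submission where

open import Defs
open import Data.Nat using (ℕ; zero; suc; _+_; _*_; _^_; _≤_; _<_; z≤n; s≤s; _∸_; _≤?_; _<?_; >-nonZero)
open import Data.Nat.Properties
open import Data.Fin using (Fin; zero; suc; toℕ; fromℕ<; combine; remQuot; punchIn; splitAt; _↑ˡ_; _↑ʳ_; join)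
import Data.Fin.Properties as Finₚ
open import Data.Fin.Permutation using (permutation; insert; remove; insert-remove; remove-insert; punchIn-permute; flip; _∘ₚ_; inverseˡ; inverseʳ; _⟨$⟩ʳ_; _⟨$⟩ˡ_) renaming (id to idₚ)
open import Data.Bool using (Bool; true; false; not; _∧_; _∨_)
import Data.Bool.Properties as Boolₚ
open import Data.Vec using ([]; _∷_; lookup; tabulate; zipWith; _[_]≔_)
import Data.Vec.Properties as Vecₚ
open import Data.Product using (∃; ∃-syntax; _×_; _,_; proj₁; proj₂; uncurry)
open import Data.Sum using (_⊎_; inj₁; inj₂; [_,_]′)
open import Function.Base using (_∘_; case_of_)
open import Relation.Nullary using (¬_; Dec; yes; no; does; contradiction)
open import Relation.Nullary.Decidable using (map′; dec-true; dec-false; _×-dec_)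
open import Relation.Binary using (DecidableEquality)
open import Relation.Binary.PropositionalEquality
open import Algebra.Properties.Semiring.Sum +-*-semiring
open import Data.Fin.Subset using (Subset)
open import Function.Bundles using (_⇔_; mk⇔)

-- Finite sums and counting

-- Behind the counting stands representation theory. For 2i ≤ n the permutation module on i-sets is
-- the sum of the Specht modules of shape (n - l, l) with l ≤ i, each occurring once, and a class
-- sum acts on each by a scalar. Its matrix is constant on i-sets exactly when the scalars for 1 ≤ l
-- ≤ i vanish. Hence constancy is inherited by smaller sets, while one step up admits a single new
-- scalar, which one trace detects. The proof replaces this by two elementary inductions that start
-- at opposite ends: `const-down` at disjoint sets, `const-up` at the diagonal. The descent needs a
-- point outside D ∪ E, and n > 2k provides it. A constant value must be |X| divided by the number
-- of i-sets, so the trace is |X| and the number of fixed i-sets comes out as 1. Averages are kept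
-- multiplied out, so that all arithmetic stays in ℕ.

𝟙 : {A : Set} → Dec A → ℕ
𝟙 (yes _) = 1
𝟙 (no _)  = 0

𝟙-true : {A : Set} (A? : Dec A) → A → 𝟙 A? ≡ 1
𝟙-true (yes _) _ = refl
𝟙-true (no ¬a) a = contradiction a ¬a

𝟙-false : {A : Set} (A? : Dec A) → ¬ A → 𝟙 A? ≡ 0
𝟙-false (yes a) ¬a = contradiction a ¬a
𝟙-false (no _)  _  = refl

𝟙-cong : {A B : Set} (A? : Dec A) (B? : Dec B) → (A → B) → (B → A) → 𝟙 A? ≡ 𝟙 B?
𝟙-cong (yes a) B? f g = sym (𝟙-true B? (f a))
𝟙-cong (no ¬a) B? f g = sym (𝟙-false B? (¬a ∘ g))

𝟙-× : {A B : Set} (A? : Dec A) (B? : Dec B) → 𝟙 (A? ×-dec B?) ≡ 𝟙 A? * 𝟙 B?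
𝟙-× (yes _) (yes _) = refl
𝟙-× (yes _) (no _)  = refl
𝟙-× (no _)  _       = refl

does-true⇒ : {A : Set} (A? : Dec A) → does A? ≡ true → A
does-true⇒ (yes a) _ = a

sum-const : ∀ m c → sum {m} (λ _ → c) ≡ m * c
sum-const zero    c = refl
sum-const (suc m) c = cong (c +_) (sum-const m c)

sum-zero : ∀ {m} (f : Fin m → ℕ) → (∀ i → f i ≡ 0) → sum f ≡ 0
sum-zero {m} f f≡0 = trans (sum-cong-≗ f≡0) (trans (sum-const m 0) (*-zeroʳ m))

-- Only the entry at i changes; stated additively to avoid subtraction.
sum-update : ∀ {m} (f g : Fin m → ℕ) i → (∀ j → j ≢ i → f j ≡ g j) → sum f + g i ≡ sum g + f i
sum-update {suc m} f g zero f≗g = begin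
  f zero + sum (f ∘ suc) + g zero ≡⟨ cong (λ s → f zero + s + g zero) (sum-cong-≗ (λ j → f≗g (suc j) λ ())) ⟩
  f zero + sum (g ∘ suc) + g zero ≡⟨ +-comm _ (g zero) ⟩
  g zero + (f zero + sum (g ∘ suc)) ≡⟨ cong (g zero +_) (+-comm (f zero) _) ⟩
  g zero + (sum (g ∘ suc) + f zero) ≡⟨ sym (+-assoc (g zero) _ _) ⟩
  g zero + sum (g ∘ suc) + f zero ∎
  where open ≡-Reasoning
sum-update {suc m} f g (suc i) f≗g = begin
  f zero + sum (f ∘ suc) + g (suc i)   ≡⟨ +-assoc (f zero) _ _ ⟩
  f zero + (sum (f ∘ suc) + g (suc i)) ≡⟨ cong₂ _+_ (f≗g zero λ ()) (sum-update (f ∘ suc) (g ∘ suc) i (λ j j≢i → f≗g (suc j) (j≢i ∘ Finₚ.suc-injective))) ⟩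
  g zero + (sum (g ∘ suc) + f (suc i)) ≡⟨ sym (+-assoc (g zero) _ _) ⟩
  g zero + sum (g ∘ suc) + f (suc i)   ∎
  where open ≡-Reasoning

sum-single : ∀ {m} (f : Fin m → ℕ) i → (∀ j → j ≢ i → f j ≡ 0) → sum f ≡ f i
sum-single {m} f i f≡0 = begin
  sum f                   ≡⟨ sym (+-identityʳ _) ⟩
  sum f + 0               ≡⟨ sum-update f (λ _ → 0) i f≡0 ⟩
  sum {m} (λ _ → 0) + f i ≡⟨ cong (_+ f i) (sum-zero {m} (λ _ → 0) (λ _ → refl)) ⟩
  f i                     ∎
  where open ≡-Reasoning

f≤sum : ∀ {m} (f : Fin m → ℕ) i → f i ≤ sum f
f≤sum {suc m} f zero    = m≤m+n _ _
f≤sum {suc m} f (suc i) = ≤-trans (f≤sum (f ∘ suc) i) (m≤n+m _ _)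

sum>0⇒∃ : ∀ {m} (f : Fin m → ℕ) → 1 ≤ sum f → ∃[ i ] 1 ≤ f i
sum>0⇒∃ {suc m} f 1≤ with f zero in eq
... | suc _ = zero , subst (1 ≤_) (sym eq) (s≤s z≤n)
... | zero  = let i , p = sum>0⇒∃ (f ∘ suc) 1≤ in suc i , p

sum-mono : ∀ {m} (f g : Fin m → ℕ) → (∀ i → f i ≤ g i) → sum f ≤ sum g
sum-mono {zero}  f g f≤g = z≤n
sum-mono {suc m} f g f≤g = +-mono-≤ (f≤g zero) (sum-mono (f ∘ suc) (g ∘ suc) (f≤g ∘ suc))

HasCard-count : ∀ {N} {P : Fin N → Set} (P? : ∀ i → Dec (P i)) → HasCard _≡_ P (sum (𝟙 ∘ P?))
HasCard-count {zero} P? = (λ ()) , (λ ()) , (λ ()) , λ ()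
HasCard-count {suc N} {P} P? with P? zero | HasCard-count (P? ∘ suc)
... | no ¬p | f , fP , inj , sur = suc ∘ f , fP , (λ s t eq → inj s t (Finₚ.suc-injective eq)) , sur′
  where
  sur′ : ∀ a → P a → ∃[ t ] a ≡ suc (f t)
  sur′ zero p = contradiction p ¬p
  sur′ (suc a) p = let t , eq = sur a p in t , cong suc eq
... | yes p | f , fP , inj , sur = f′ , fP′ , inj′ , sur′
  where
  f′ : Fin (suc (sum (𝟙 ∘ P? ∘ suc))) → Fin (suc N)
  f′ zero = zero
  f′ (suc t) = suc (f t)
  fP′ : ∀ t → P (f′ t)
  fP′ zero = p
  fP′ (suc t) = fP t
  inj′ : ∀ s t → f′ s ≡ f′ t → s ≡ t
  inj′ zero zero _ = refl
  inj′ (suc s) (suc t) eq = cong suc (inj s t (Finₚ.suc-injective eq))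
  sur′ : ∀ a → P a → ∃[ t ] a ≡ f′ t
  sur′ zero _ = zero , refl
  sur′ (suc a) p = let t , eq = sur a p in suc t , cong suc eq

module _ {A B : Set} {_≈_ : A → A → Set} {_∼_ : B → B → Set} where

  -- The maps need to be mutually inverse only on `P` and `Q`. This is the situation of
  -- factorizations g = ab, where `b` can be recovered from `a` only because the product is `g`.
  HasCard-transfer : (∀ {a b c} → a ≈ b → b ≈ c → a ≈ c) → (∀ {a b} → a ≈ b → b ≈ a) →
    (∀ {a b c} → a ∼ b → b ∼ c → a ∼ c) → (∀ {a b} → a ∼ b → b ∼ a) →
    {P : A → Set} {Q : B → Set} (φ : A → B) (ψ : B → A) →
    (∀ {a a′} → a ≈ a′ → φ a ∼ φ a′) → (∀ {b b′} → b ∼ b′ → ψ b ≈ ψ b′) →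
    (∀ a → P a → Q (φ a)) → (∀ b → Q b → P (ψ b)) →
    (∀ a → P a → ψ (φ a) ≈ a) → (∀ b → Q b → φ (ψ b) ∼ b) →
    ∀ {r} → HasCard _≈_ P r → HasCard _∼_ Q r
  HasCard-transfer trA syA trB syB φ ψ φ-cong ψ-cong PQ QP ψφ φψ (f , fP , inj , sur) =
    φ ∘ f ,
    (λ t → PQ _ (fP t)) ,
    (λ s t eq → inj s t (trA (syA (ψφ _ (fP s))) (trA (ψ-cong eq) (ψφ _ (fP t))))) ,
    (λ b q → let t , eq = sur (ψ b) (QP b q) in t , trB (syB (φψ b q)) (φ-cong eq))

module _ {A : Set} {_≈_ : A → A → Set} (trA : ∀ {a b c} → a ≈ b → b ≈ c → a ≈ c) (syA : ∀ {a b} → a ≈ b → b ≈ a) where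

  HasCard-≤ : ∀ {P : A → Set} {r s} → HasCard _≈_ P r → HasCard _≈_ P s → r ≤ s
  HasCard-≤ (f , fP , inj , sur) (f′ , fP′ , inj′ , sur′) =
    Finₚ.injective⇒≤ {f = λ t → proj₁ (sur′ (f t) (fP t))}
      λ {s} {t} eq → inj s t (trA (proj₂ (sur′ (f s) (fP s)))
        (syA (subst (λ u → f t ≈ f′ u) (sym eq) (proj₂ (sur′ (f t) (fP t))))))

  HasCard-unique : ∀ {P : A → Set} {r s} → HasCard _≈_ P r → HasCard _≈_ P s → r ≡ s
  HasCard-unique c d = ≤-antisym (HasCard-≤ c d) (HasCard-≤ d c)

-- Enumerations of permutations and of subsets

-- Relative to an equivalence because permutations are records of functions, which can be compared
-- only pointwise. `index-cong` makes the index depend on the class alone.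
record Enumeration (A : Set) (_≈_ : A → A → Set) : Set where
  field
    size       : ℕ
    enum       : Fin size → A
    index      : A → Fin size
    enum-index : ∀ a → enum (index a) ≈ a
    index-enum : ∀ t → index (enum t) ≡ t
    index-cong : ∀ {a b} → a ≈ b → index a ≡ index b
    ≈-sym      : ∀ {a b} → a ≈ b → b ≈ a
    ≈-trans    : ∀ {a b c} → a ≈ b → b ≈ c → a ≈ c

  ≈-reflexive : ∀ {a b} → a ≡ b → a ≈ b
  ≈-reflexive {a} refl = ≈-trans (≈-sym (enum-index a)) (enum-index a)

  total : (A → ℕ) → ℕ
  total f = sum (f ∘ enum)

  total-cong : ∀ {f g} → (∀ a → f a ≡ g a) → total f ≡ total g
  total-cong f≗g = sum-cong-≗ (f≗g ∘ enum)

  total-reindex : ∀ f → (∀ {a b} → a ≈ b → f a ≡ f b) →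
    (φ ψ : A → A) → (∀ {a b} → a ≈ b → φ a ≈ φ b) → (∀ {a b} → a ≈ b → ψ a ≈ ψ b) →
    (∀ a → φ (ψ a) ≈ a) → (∀ a → ψ (φ a) ≈ a) → total f ≡ total (f ∘ φ)
  total-reindex f f-cong φ ψ φ-cong ψ-cong φψ ψφ =
    trans (sum-permute (f ∘ enum) π) (sum-cong-≗ (λ t → f-cong (enum-index (φ (enum t)))))
    where
    inv : ∀ (α β : A → A) → (∀ {a b} → a ≈ b → α a ≈ α b) → (∀ a → α (β a) ≈ a) →
          ∀ t → index (α (enum (index (β (enum t))))) ≡ t
    inv α β α-cong αβ t = trans
      (index-cong (≈-trans (α-cong (enum-index (β (enum t)))) (αβ (enum t)))) (index-enum t)
    π = permutation (index ∘ φ ∘ enum) (index ∘ ψ ∘ enum) (inv φ ψ φ-cong φψ) (inv ψ φ ψ-cong ψφ)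

  total-single : ∀ f → (∀ {a b} → a ≈ b → f a ≡ f b) → ∀ a → (∀ b → ¬ (b ≈ a) → f b ≡ 0) → total f ≡ f a
  total-single f f-cong a f≡0 = trans
    (sum-single (f ∘ enum) (index a) (λ t t≢ → f≡0 (enum t) (λ eq → t≢ (trans (sym (index-enum t)) (index-cong eq)))))
    (f-cong (enum-index a))

  HasCard-total : ∀ {P : A → Set} (P? : ∀ a → Dec (P a)) → (∀ {a b} → a ≈ b → P a → P b) →
    HasCard _≈_ P (total (𝟙 ∘ P?))
  HasCard-total {P} P? P-cong =
    let f , fP , inj , sur = HasCard-count (P? ∘ enum) in
    enum ∘ f , fP ,
    (λ s t eq → inj s t (trans (sym (index-enum (f s))) (trans (index-cong eq) (index-enum (f t))))) ,
    (λ a p → let t , eq = sur (index a) (P-cong (≈-sym (enum-index a)) p)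
             in t , ≈-trans (≈-sym (enum-index a)) (≈-reflexive (cong enum eq)))

  any-dec : ∀ {P : A → Set} → (∀ a → Dec (P a)) → (∀ {a b} → a ≈ b → P a → P b) → Dec (∃ P)
  any-dec P? P-cong = map′ (λ (t , p) → enum t , p) (λ (a , p) → index a , P-cong (≈-sym (enum-index a)) p)
    (Finₚ.any? (P? ∘ enum))

≈ₚ-sym : ∀ {n} {π ρ : Perm n} → π ≈ₚ ρ → ρ ≈ₚ π
≈ₚ-sym eq i = sym (eq i)

≈ₚ-trans : ∀ {n} {π ρ σ : Perm n} → π ≈ₚ ρ → ρ ≈ₚ σ → π ≈ₚ σ
≈ₚ-trans eq eq′ i = trans (eq i) (eq′ i)

⟨$⟩ˡ-cong : ∀ {n} (π ρ : Perm n) → π ≈ₚ ρ → ∀ i → π ⟨$⟩ˡ i ≡ ρ ⟨$⟩ˡ i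
⟨$⟩ˡ-cong π ρ eq i = begin
  π ⟨$⟩ˡ i                   ≡⟨ cong (π ⟨$⟩ˡ_) (sym (inverseʳ ρ)) ⟩
  π ⟨$⟩ˡ (ρ ⟨$⟩ʳ (ρ ⟨$⟩ˡ i)) ≡⟨ cong (π ⟨$⟩ˡ_) (sym (eq _)) ⟩
  π ⟨$⟩ˡ (π ⟨$⟩ʳ (ρ ⟨$⟩ˡ i)) ≡⟨ inverseˡ π ⟩
  ρ ⟨$⟩ˡ i                   ∎
  where open ≡-Reasoning

remove-cong : ∀ {n} (π ρ : Perm (suc n)) → π ≈ₚ ρ → remove zero π ≈ₚ remove zero ρ
remove-cong π ρ eq j = Finₚ.punchIn-injective (ρ ⟨$⟩ʳ zero) _ _ (begin
  punchIn (ρ ⟨$⟩ʳ zero) (remove zero π ⟨$⟩ʳ j) ≡⟨ cong (λ i → punchIn i (remove zero π ⟨$⟩ʳ j)) (sym (eq zero)) ⟩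
  punchIn (π ⟨$⟩ʳ zero) (remove zero π ⟨$⟩ʳ j) ≡⟨ sym (punchIn-permute π zero j) ⟩
  π ⟨$⟩ʳ suc j                                 ≡⟨ eq (suc j) ⟩
  ρ ⟨$⟩ʳ suc j                                 ≡⟨ punchIn-permute ρ zero j ⟩
  punchIn (ρ ⟨$⟩ʳ zero) (remove zero ρ ⟨$⟩ʳ j) ∎)
  where open ≡-Reasoning

insert-cong : ∀ {n} j (π ρ : Perm n) → π ≈ₚ ρ → insert zero j π ≈ₚ insert zero j ρ
insert-cong j π ρ eq zero    = refl
insert-cong j π ρ eq (suc i) = cong (punchIn j) (eq i)

-- A permutation is coded by the image of `zero` and by what remains after deleting `zero` and that
-- image; the size is thus n factorial.
perms : ∀ n → Enumeration (Perm n) _≈ₚ_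
perms zero = record
  { size = 1 ; enum = λ _ → idₚ ; index = λ _ → zero
  ; enum-index = λ _ () ; index-enum = λ { zero → refl } ; index-cong = λ _ → refl
  ; ≈-sym = λ {a} {b} → ≈ₚ-sym {π = a} {b} ; ≈-trans = λ {a} {b} {c} → ≈ₚ-trans {π = a} {b} {c} }
perms (suc n) = record
  { size = suc n * size ; enum = enum′ ; index = index′
  ; enum-index = enum-index′ ; index-enum = index-enum′ ; index-cong = λ {a} {b} → index-cong′ a b
  ; ≈-sym = λ {a} {b} → ≈ₚ-sym {π = a} {b} ; ≈-trans = λ {a} {b} {c} → ≈ₚ-trans {π = a} {b} {c} }
  where
  open Enumeration (perms n)
  enum″ : Fin (suc n) × Fin size → Perm (suc n)
  enum″ (j , t) = insert zero j (enum t)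
  enum′ : Fin (suc n * size) → Perm (suc n)
  enum′ = enum″ ∘ remQuot size
  index′ : Perm (suc n) → Fin (suc n * size)
  index′ π = combine (π ⟨$⟩ʳ zero) (index (remove zero π))
  enum-index′ : ∀ π → enum′ (index′ π) ≈ₚ π
  enum-index′ π i = trans
    (cong (λ jt → enum″ jt ⟨$⟩ʳ i) (Finₚ.remQuot-combine (π ⟨$⟩ʳ zero) (index (remove zero π))))
    (trans (insert-cong (π ⟨$⟩ʳ zero) _ _ (enum-index (remove zero π)) i) (insert-remove zero π i))
  index-enum″ : ∀ jt → index′ (enum″ jt) ≡ uncurry combine jt
  index-enum″ (j , t) = cong (combine j) (trans (index-cong (remove-insert zero j (enum t))) (index-enum t))
  index-enum′ : ∀ t → index′ (enum′ t) ≡ t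
  index-enum′ t = trans (index-enum″ (remQuot size t)) (Finₚ.combine-remQuot {suc n} size t)
  index-cong′ : ∀ π ρ → π ≈ₚ ρ → index′ π ≡ index′ ρ
  index-cong′ π ρ eq = cong₂ combine (eq zero) (index-cong (remove-cong π ρ eq))

subsets : ∀ n → Enumeration (Subset n) _≡_
subsets zero = record
  { size = 1 ; enum = λ _ → [] ; index = λ _ → zero
  ; enum-index = λ { [] → refl } ; index-enum = λ { zero → refl } ; index-cong = λ _ → refl
  ; ≈-sym = sym ; ≈-trans = trans }
subsets (suc n) = record
  { size = size + size ; enum = enum″ ∘ splitAt size ; index = index′
  ; enum-index = enum-index′ ; index-enum = λ t → trans (index-enum″ (splitAt size t)) (Finₚ.join-splitAt size size t)
  ; index-cong = cong index′
  ; ≈-sym = sym ; ≈-trans = trans }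
  where
  open Enumeration (subsets n)
  enum″ : Fin size ⊎ Fin size → Subset (suc n)
  enum″ (inj₁ t) = true ∷ enum t
  enum″ (inj₂ t) = false ∷ enum t
  index′ : Subset (suc n) → Fin (size + size)
  index′ (true ∷ T)  = index T ↑ˡ size
  index′ (false ∷ T) = size ↑ʳ index T
  enum-index′ : ∀ T → enum″ (splitAt size (index′ T)) ≡ T
  enum-index′ (true ∷ T)  = trans (cong enum″ (Finₚ.splitAt-↑ˡ size (index T) size)) (cong (true ∷_) (enum-index T))
  enum-index′ (false ∷ T) = trans (cong enum″ (Finₚ.splitAt-↑ʳ size size (index T))) (cong (false ∷_) (enum-index T))
  index-enum″ : ∀ s → index′ (enum″ s) ≡ join size size s
  index-enum″ (inj₁ t) = cong (_↑ˡ size) (index-enum t)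
  index-enum″ (inj₂ t) = cong (size ↑ʳ_) (index-enum t)

-- Subsets and the action of permutations on them

bit : Bool → ℕ
bit true  = 1
bit false = 0

card : ∀ {n} → Subset n → ℕ
card T = sum (bit ∘ lookup T)

meet : ∀ {n} → Subset n → Subset n → ℕ
meet D E = sum (λ p → bit (lookup D p) * bit (lookup E p))

subset-ext : ∀ {n} {S T : Subset n} → (∀ p → lookup S p ≡ lookup T p) → S ≡ T
subset-ext {S = S} {T} eq = trans (sym (Vecₚ.tabulate∘lookup S)) (trans (Vecₚ.tabulate-cong eq) (Vecₚ.tabulate∘lookup T))

card-mono : ∀ {n} {S T : Subset n} → (∀ p → lookup S p ≡ true → lookup T p ≡ true) → card S ≤ card T
card-mono {S = S} {T} S⊆T = sum-mono (bit ∘ lookup S) (bit ∘ lookup T) pointwise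
  where
  pointwise : ∀ p → bit (lookup S p) ≤ bit (lookup T p)
  pointwise p with lookup S p | S⊆T p
  ... | false | _ = z≤n
  ... | true  | h rewrite h refl = ≤-refl

HasCard-card : ∀ {n} (T : Subset n) → HasCard _≡_ (λ p → lookup T p ≡ true) (card T)
HasCard-card T = subst (HasCard _≡_ _) (sum-cong-≗ (λ p → 𝟙-bit (lookup T p)))
  (HasCard-count (λ p → lookup T p Boolₚ.≟ true))
  where
  𝟙-bit : ∀ b → 𝟙 (b Boolₚ.≟ true) ≡ bit b
  𝟙-bit true  = refl
  𝟙-bit false = refl

lookup-≔-≢ : ∀ {n} (T : Subset n) {p q} b → q ≢ p → lookup (T [ p ]≔ b) q ≡ lookup T q
lookup-≔-≢ T {p} {q} b q≢p = Vecₚ.lookup∘update′ q≢p T b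

lookup-≔ : ∀ {n} (T : Subset n) p b → lookup (T [ p ]≔ b) p ≡ b
lookup-≔ T p b = Vecₚ.lookup∘update p T b

card-≔ : ∀ {n} (T : Subset n) p b → card (T [ p ]≔ b) + bit (lookup T p) ≡ card T + bit b
card-≔ T p b = trans
  (sum-update (bit ∘ lookup (T [ p ]≔ b)) (bit ∘ lookup T) p (λ q q≢p → cong bit (lookup-≔-≢ T b q≢p)))
  (cong (λ c → card T + bit c) (lookup-≔ T p b))

card-insert : ∀ {n} (T : Subset n) p → lookup T p ≡ false → card (T [ p ]≔ true) ≡ suc (card T)
card-insert T p p∉T = trans (sym (+-identityʳ _))
  (trans (cong (λ b → card (T [ p ]≔ true) + bit b) (sym p∉T)) (trans (card-≔ T p true) (+-comm (card T) 1)))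

card-remove : ∀ {n} (T : Subset n) p → lookup T p ≡ true → suc (card (T [ p ]≔ false)) ≡ card T
card-remove T p p∈T = trans (+-comm 1 _)
  (trans (cong (λ b → card (T [ p ]≔ false) + bit b) (sym p∈T)) (trans (card-≔ T p false) (+-identityʳ _)))

meet-≔ˡ : ∀ {n} (D E : Subset n) p b →
  meet (D [ p ]≔ b) E + bit (lookup D p) * bit (lookup E p) ≡ meet D E + bit b * bit (lookup E p)
meet-≔ˡ D E p b = trans
  (sum-update (λ q → bit (lookup (D [ p ]≔ b) q) * bit (lookup E q)) (λ q → bit (lookup D q) * bit (lookup E q)) p
    (λ q q≢p → cong (λ c → bit c * bit (lookup E q)) (lookup-≔-≢ D b q≢p)))
  (cong (λ c → meet D E + bit c * bit (lookup E p)) (lookup-≔ D p b))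

meet-comm : ∀ {n} (D E : Subset n) → meet D E ≡ meet E D
meet-comm D E = sum-cong-≗ (λ p → *-comm (bit (lookup D p)) _)

meet-insertˡ : ∀ {n} (D E : Subset n) p → lookup D p ≡ false →
  meet (D [ p ]≔ true) E ≡ meet D E + bit (lookup E p)
meet-insertˡ D E p p∉D = begin
  meet (D [ p ]≔ true) E                                         ≡⟨ sym (+-identityʳ _) ⟩
  meet (D [ p ]≔ true) E + 0                                     ≡⟨ cong (λ b → meet (D [ p ]≔ true) E + bit b * bit (lookup E p)) (sym p∉D) ⟩
  meet (D [ p ]≔ true) E + bit (lookup D p) * bit (lookup E p)   ≡⟨ meet-≔ˡ D E p true ⟩
  meet D E + (bit (lookup E p) + 0)                              ≡⟨ cong (meet D E +_) (+-identityʳ _) ⟩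
  meet D E + bit (lookup E p)                                    ∎
  where open ≡-Reasoning

meet-removeˡ : ∀ {n} (D E : Subset n) p → lookup D p ≡ true →
  meet (D [ p ]≔ false) E + bit (lookup E p) ≡ meet D E
meet-removeˡ D E p p∈D = begin
  meet (D [ p ]≔ false) E + bit (lookup E p)                      ≡⟨ cong (meet (D [ p ]≔ false) E +_) (sym (*-identityˡ _)) ⟩
  meet (D [ p ]≔ false) E + bit true * bit (lookup E p)           ≡⟨ cong (λ b → meet (D [ p ]≔ false) E + bit b * bit (lookup E p)) (sym p∈D) ⟩
  meet (D [ p ]≔ false) E + bit (lookup D p) * bit (lookup E p)   ≡⟨ meet-≔ˡ D E p false ⟩
  meet D E + 0                                                    ≡⟨ +-identityʳ _ ⟩
  meet D E                                                        ∎
  where open ≡-Reasoning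

meet-insertʳ : ∀ {n} (D E : Subset n) p → lookup E p ≡ false →
  meet D (E [ p ]≔ true) ≡ meet D E + bit (lookup D p)
meet-insertʳ D E p p∉E = trans (meet-comm D (E [ p ]≔ true)) (trans (meet-insertˡ E D p p∉E) (cong (_+ bit (lookup D p)) (meet-comm E D)))

meet-removeʳ : ∀ {n} (D E : Subset n) p → lookup E p ≡ true →
  meet D (E [ p ]≔ false) + bit (lookup D p) ≡ meet D E
meet-removeʳ D E p p∈E = trans (cong (_+ bit (lookup D p)) (meet-comm D (E [ p ]≔ false))) (trans (meet-removeˡ E D p p∈E) (meet-comm E D))

meet-self : ∀ {n} (D : Subset n) → meet D D ≡ card D
meet-self D = sum-cong-≗ (λ p → bit-idem (lookup D p))
  where
  bit-idem : ∀ b → bit b * bit b ≡ bit b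
  bit-idem true  = refl
  bit-idem false = refl

module _ {n} (D E : Subset n) where

  sum-split : sum (λ p → bit (lookup D p) * bit (not (lookup E p))) + meet D E ≡ card D
  sum-split = trans (sym (∑-distrib-+ (λ p → bit (lookup D p) * bit (not (lookup E p))) (λ p → bit (lookup D p) * bit (lookup E p))))
    (sum-cong-≗ (λ p → pointwise (lookup D p) (lookup E p)))
    where
    pointwise : ∀ b c → bit b * bit (not c) + bit b * bit c ≡ bit b
    pointwise true  true  = refl
    pointwise true  false = refl
    pointwise false _     = refl

  sum-complement : sum (λ p → bit (not (lookup D p)) * bit (not (lookup E p))) + (sum (λ p → bit (lookup E p) * bit (not (lookup D p))) + card D) ≡ n
  sum-complement = begin
    sum f + (sum g + card D)           ≡⟨ cong (sum f +_) (sym (∑-distrib-+ g (bit ∘ lookup D))) ⟩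
    sum f + sum (λ p → g p + bit (lookup D p)) ≡⟨ sym (∑-distrib-+ f (λ p → g p + bit (lookup D p))) ⟩
    sum (λ p → f p + (g p + bit (lookup D p))) ≡⟨ sum-cong-≗ (λ p → pointwise (lookup D p) (lookup E p)) ⟩
    sum {n} (λ _ → 1)                  ≡⟨ sum-const n 1 ⟩
    n * 1                              ≡⟨ *-identityʳ n ⟩
    n                                  ∎
    where
    open ≡-Reasoning
    f g : Fin n → ℕ
    f p = bit (not (lookup D p)) * bit (not (lookup E p))
    g p = bit (lookup E p) * bit (not (lookup D p))
    pointwise : ∀ b c → bit (not b) * bit (not c) + (bit c * bit (not b) + bit b) ≡ 1
    pointwise true  true  = refl
    pointwise true  false = refl
    pointwise false true  = refl
    pointwise false false = refl

-- Greedy matching: as the counts agree, some `j` has the colour of `zero` under `g`. Pairing `zero`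
-- with `j` and deleting both lowers the count of that colour by one on either side, so the
-- hypothesis survives.
matching : ∀ {n} {A : Set} (_≟_ : DecidableEquality A) (f g : Fin n → A) →
  (∀ c → sum (λ i → 𝟙 (f i ≟ c)) ≡ sum (λ i → 𝟙 (g i ≟ c))) → ∃[ π ] (∀ i → g (π ⟨$⟩ʳ i) ≡ f i)
matching {zero}  _≟_ f g _  = idₚ , λ ()
matching {suc n} _≟_ f g eq = insert zero j (proj₁ rest) , spec
  where
  c₀ = f zero
  found : ∃[ i ] 1 ≤ 𝟙 (g i ≟ c₀)
  found = sum>0⇒∃ (λ i → 𝟙 (g i ≟ c₀))
    (subst (1 ≤_) (eq c₀) (≤-trans (≤-reflexive (sym (𝟙-true (c₀ ≟ c₀) refl))) (f≤sum (λ i → 𝟙 (f i ≟ c₀)) zero)))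
  j = proj₁ found
  1≤𝟙⇒ : ∀ {B : Set} (B? : Dec B) → 1 ≤ 𝟙 B? → B
  1≤𝟙⇒ (yes b) _ = b
  gj≡c₀ : g j ≡ c₀
  gj≡c₀ = 1≤𝟙⇒ (g j ≟ c₀) (proj₂ found)
  rest = matching _≟_ (f ∘ suc) (g ∘ punchIn j) (λ c → +-cancelˡ-≡ (𝟙 (c₀ ≟ c)) _ _ (begin
    sum (λ i → 𝟙 (f i ≟ c))                                ≡⟨ eq c ⟩
    sum (λ i → 𝟙 (g i ≟ c))                                ≡⟨ sum-remove {i = j} (λ i → 𝟙 (g i ≟ c)) ⟩
    𝟙 (g j ≟ c) + sum (λ i → 𝟙 (g (punchIn j i) ≟ c))      ≡⟨ cong (λ d → 𝟙 (d ≟ c) + sum (λ i → 𝟙 (g (punchIn j i) ≟ c))) gj≡c₀ ⟩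
    𝟙 (c₀ ≟ c) + sum (λ i → 𝟙 (g (punchIn j i) ≟ c))       ∎))
    where open ≡-Reasoning
  spec : ∀ i → g (insert zero j (proj₁ rest) ⟨$⟩ʳ i) ≡ f i
  spec zero    = gj≡c₀
  spec (suc i) = proj₂ rest i

-- Comparing membership at every point says that `a` carries `D` onto `E`, complement included. A
-- record, so that `D` and `E` can be inferred from a proof; `lookup` would hide them from
-- unification.
record Maps {n} (a : Perm n) (D E : Subset n) : Set where
  constructor mk
  field at : ∀ p → lookup E (a ⟨$⟩ʳ p) ≡ lookup D p

open Maps

maps? : ∀ {n} (a : Perm n) D E → Dec (Maps a D E)
maps? a D E = map′ mk at (Finₚ.all? (λ p → lookup E (a ⟨$⟩ʳ p) Boolₚ.≟ lookup D p))

image : ∀ {n} → Perm n → Subset n → Subset n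
image a D = tabulate (λ q → lookup D (a ⟨$⟩ˡ q))

maps-image : ∀ {n} (a : Perm n) D → Maps a D (image a D)
maps-image a D = mk λ p → trans (Vecₚ.lookup∘tabulate _ (a ⟨$⟩ʳ p)) (cong (lookup D) (inverseˡ a))

maps⇒image : ∀ {n} (a : Perm n) {D E} → Maps a D E → E ≡ image a D
maps⇒image a {D} {E} m = subset-ext (λ q → trans (cong (lookup E) (sym (inverseʳ a)))
  (trans (at m (a ⟨$⟩ˡ q)) (sym (Vecₚ.lookup∘tabulate _ q))))

maps-card : ∀ {n} (a : Perm n) {D E} → Maps a D E → card D ≡ card E
maps-card a {D} {E} m = sym (trans (sum-permute (bit ∘ lookup E) a) (sum-cong-≗ (λ p → cong bit (at m p))))

maps-inverse : ∀ {n} (h : Perm n) {D E} → Maps h D E → ∀ q → lookup D (h ⟨$⟩ˡ q) ≡ lookup E q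
maps-inverse h {D} {E} m q = trans (sym (at m (h ⟨$⟩ˡ q))) (cong (lookup E) (inverseʳ h))

-- Colour each point by its membership in the two sets. The sizes of both sets and of their
-- intersection determine the sizes of all four colour classes, the last one through the total `n`,
-- and `matching` then supplies `h`.
pair-transitive : ∀ {n} (D E D′ E′ : Subset n) → card D ≡ card D′ → card E ≡ card E′ → meet D E ≡ meet D′ E′ →
  ∃[ h ] (Maps h D D′ × Maps h E E′)
pair-transitive {n} D E D′ E′ cD cE cDE =
  let h , spec = matching _≟₂_ (colour D E) (colour D′ E′) counts
  in h , mk (cong proj₁ ∘ spec) , mk (cong proj₂ ∘ spec)
  where
  open import Data.Product.Properties using (≡-dec)
  _≟₂_ : DecidableEquality (Bool × Bool)
  _≟₂_ = ≡-dec Boolₚ._≟_ Boolₚ._≟_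
  colour : Subset n → Subset n → Fin n → Bool × Bool
  colour D E p = lookup D p , lookup E p
  count : Subset n → Subset n → Bool × Bool → ℕ
  count D E c = sum (λ p → 𝟙 (colour D E p ≟₂ c))
  #tt : ∀ D E → count D E (true , true) ≡ meet D E
  #tt D E = sum-cong-≗ (λ p → go (lookup D p) (lookup E p))
    where
    go : ∀ b c → 𝟙 ((b , c) ≟₂ (true , true)) ≡ bit b * bit c
    go true  true  = refl
    go true  false = refl
    go false true  = refl
    go false false = refl
  #tf : ∀ D E → count D E (true , false) ≡ sum (λ p → bit (lookup D p) * bit (not (lookup E p)))
  #tf D E = sum-cong-≗ (λ p → go (lookup D p) (lookup E p))
    where
    go : ∀ b c → 𝟙 ((b , c) ≟₂ (true , false)) ≡ bit b * bit (not c)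
    go true  true  = refl
    go true  false = refl
    go false true  = refl
    go false false = refl
  #ft : ∀ D E → count D E (false , true) ≡ sum (λ p → bit (lookup E p) * bit (not (lookup D p)))
  #ft D E = sum-cong-≗ (λ p → go (lookup D p) (lookup E p))
    where
    go : ∀ b c → 𝟙 ((b , c) ≟₂ (false , true)) ≡ bit c * bit (not b)
    go true  true  = refl
    go true  false = refl
    go false true  = refl
    go false false = refl
  #ff : ∀ D E → count D E (false , false) ≡ sum (λ p → bit (not (lookup D p)) * bit (not (lookup E p)))
  #ff D E = sum-cong-≗ (λ p → go (lookup D p) (lookup E p))
    where
    go : ∀ b c → 𝟙 ((b , c) ≟₂ (false , false)) ≡ bit (not b) * bit (not c)
    go true  true  = refl
    go true  false = refl
    go false true  = refl
    go false false = refl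
  only : ∀ {D E D′ E′} → card D ≡ card D′ → meet D E ≡ meet D′ E′ →
    sum (λ p → bit (lookup D p) * bit (not (lookup E p))) ≡ sum (λ p → bit (lookup D′ p) * bit (not (lookup E′ p)))
  only {D} {E} {D′} {E′} c m = +-cancelʳ-≡ (meet D E) _ _ (trans (sum-split D E)
    (trans c (trans (sym (sum-split D′ E′)) (cong (sum (λ p → bit (lookup D′ p) * bit (not (lookup E′ p))) +_) (sym m)))))
  only-E = only {E} {D} {E′} {D′} cE (trans (meet-comm E D) (trans cDE (meet-comm D′ E′)))
  neither : sum (λ p → bit (not (lookup D p)) * bit (not (lookup E p))) ≡ sum (λ p → bit (not (lookup D′ p)) * bit (not (lookup E′ p)))
  neither = +-cancelʳ-≡ _ _ _ (trans (sum-complement D E)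
    (trans (sym (sum-complement D′ E′)) (cong (sum (λ p → bit (not (lookup D′ p)) * bit (not (lookup E′ p))) +_)
      (cong₂ _+_ (sym only-E) (sym cD)))))
  counts : ∀ c → count D E c ≡ count D′ E′ c
  counts (true , true)   = trans (#tt D E) (trans cDE (sym (#tt D′ E′)))
  counts (true , false)  = trans (#tf D E) (trans (only {D} {E} {D′} {E′} cD cDE) (sym (#tf D′ E′)))
  counts (false , true)  = trans (#ft D E) (trans only-E (sym (#ft D′ E′)))
  counts (false , false) = trans (#ff D E) (trans neither (sym (#ff D′ E′)))

set-transitive : ∀ {n} (D D′ : Subset n) → card D ≡ card D′ → ∃[ h ] Maps h D D′
set-transitive D D′ c =
  let h , m , _ = pair-transitive D D D′ D′ c c (trans (meet-self D) (trans c (sym (meet-self D′)))) in h , m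

-- Class functions acting on subsets

-- `∘ₚ` applies its left argument first, so this is h a h⁻¹.
conj : ∀ {n} → Perm n → Perm n → Perm n
conj h a = flip h ∘ₚ a ∘ₚ h

conj-cong : ∀ {n} (h a b : Perm n) → a ≈ₚ b → conj h a ≈ₚ conj h b
conj-cong h a b eq i = cong (h ⟨$⟩ʳ_) (eq (h ⟨$⟩ˡ i))

conj-flip : ∀ {n} (h a : Perm n) → conj h (conj (flip h) a) ≈ₚ a
conj-flip h a i = trans (inverseʳ h) (cong (a ⟨$⟩ʳ_) (inverseʳ h))

flip-conj : ∀ {n} (h a : Perm n) → conj (flip h) (conj h a) ≈ₚ a
flip-conj h a i = trans (inverseˡ h) (cong (a ⟨$⟩ʳ_) (inverseˡ h))

maps-cong : ∀ {n} (a b : Perm n) {D E} → a ≈ₚ b → Maps a D E → Maps b D E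
maps-cong a b {E = E} eq m = mk λ p → trans (cong (lookup E) (sym (eq p))) (at m p)

maps-conj : ∀ {n} (h a : Perm n) {D E D′ E′} → Maps h D D′ → Maps h E E′ → Maps a D E → Maps (conj h a) D′ E′
maps-conj h a hD hE m = mk λ q → trans (at hE _) (trans (at m _) (maps-inverse h hD q))

maps-conj⁻ : ∀ {n} (h a : Perm n) {D E D′ E′} → Maps h D D′ → Maps h E E′ → Maps (conj h a) D′ E′ → Maps a D E
maps-conj⁻ h a {D} {E} {D′} {E′} hD hE m = mk λ p → begin
  lookup E (a ⟨$⟩ʳ p)                                  ≡⟨ sym (at hE _) ⟩
  lookup E′ (h ⟨$⟩ʳ (a ⟨$⟩ʳ p))                         ≡⟨ cong (λ q → lookup E′ (h ⟨$⟩ʳ (a ⟨$⟩ʳ q))) (sym (inverseˡ h)) ⟩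
  lookup E′ (conj h a ⟨$⟩ʳ (h ⟨$⟩ʳ p))                  ≡⟨ at m _ ⟩
  lookup D′ (h ⟨$⟩ʳ p)                                  ≡⟨ at hD p ⟩
  lookup D p                                            ∎
  where open ≡-Reasoning

module Perms {n} = Enumeration (perms n)
module Subsets {n} = Enumeration (subsets n)

fixedCount : ∀ {n} → ℕ → Perm n → ℕ
fixedCount i a = Subsets.total (λ T → 𝟙 ((card T ≟ i) ×-dec maps? a T T))

subsetCount : ℕ → ℕ → ℕ
subsetCount n i = Subsets.total {n} (λ T → 𝟙 (card T ≟ i))

module ClassFunction {n} (w : Perm n → ℕ) (w-cong : ∀ {a b} → a ≈ₚ b → w a ≡ w b)
  (w-conj : ∀ h a → w (conj h a) ≡ w a) where

  -- The entries of the matrix by which Σ w(a) a acts on the permutation module spanned by all subsets.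
  entry : Subset n → Subset n → ℕ
  entry D E = Perms.total (λ a → w a * 𝟙 (maps? a D E))

  weight : ℕ
  weight = Perms.total w

  term-cong : ∀ D E {a b} → a ≈ₚ b → w a * 𝟙 (maps? a D E) ≡ w b * 𝟙 (maps? b D E)
  term-cong D E {a} {b} eq = cong₂ _*_ (w-cong eq)
    (𝟙-cong (maps? a D E) (maps? b D E) (maps-cong a b eq) (maps-cong b a (sym ∘ eq)))

  -- Reindexing the sum by a ↦ h a h⁻¹ keeps the weights, and h a h⁻¹ carries `D′` to `E′` exactly
  -- when `a` carries `D` to `E`.
  entry-invariant : ∀ h {D E D′ E′} → Maps h D D′ → Maps h E E′ → entry D E ≡ entry D′ E′
  entry-invariant h {D} {E} {D′} {E′} hD hE = sym (trans
    (Perms.total-reindex (λ a → w a * 𝟙 (maps? a D′ E′)) (term-cong D′ E′)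
      (conj h) (conj (flip h)) (λ {a} {b} → conj-cong h a b) (λ {a} {b} → conj-cong (flip h) a b)
      (conj-flip h) (flip-conj h))
    (Perms.total-cong {f = λ a → w (conj h a) * 𝟙 (maps? (conj h a) D′ E′)} {g = λ a → w a * 𝟙 (maps? a D E)}
      (λ a → cong₂ _*_ (w-conj h a)
        (𝟙-cong (maps? (conj h a) D′ E′) (maps? a D E) (maps-conj⁻ h a hD hE) (maps-conj h a hD hE)))))

  entry-meet : ∀ {D E D′ E′} → card D ≡ card D′ → card E ≡ card E′ → meet D E ≡ meet D′ E′ → entry D E ≡ entry D′ E′
  entry-meet {D} {E} {D′} {E′} cD cE cDE =
    let h , hD , hE = pair-transitive D E D′ E′ cD cE cDE in entry-invariant h hD hE

  -- Both sides count pairs (a , p) with p ∉ D and a (D ∪ {p}) = E; on the right q = a p.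
  exchange : ∀ D E →
    sum (λ p → bit (not (lookup D p)) * entry (D [ p ]≔ true) E) ≡
    sum (λ q → bit (lookup E q) * entry D (E [ q ]≔ false))
  exchange D E = begin
    sum (λ p → bit (not (lookup D p)) * entry (D [ p ]≔ true) E)
      ≡⟨ sum-cong-≗ {n} (λ p → *-distribˡ-sum (bit (not (lookup D p))) (λ t → l p (Perms.enum t))) ⟩
    sum (λ p → Perms.total (λ a → bit (not (lookup D p)) * l p a))
      ≡⟨ ∑-comm {n} (λ p t → bit (not (lookup D p)) * l p (Perms.enum t)) ⟩
    Perms.total (λ a → sum (λ p → bit (not (lookup D p)) * l p a))
      ≡⟨ Perms.total-cong {g = λ a → sum (λ p → bit (lookup E p) * r p a)} (λ a → trans
           (sum-cong-≗ (λ p → pointwise a p))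
           (sym (sum-permute (λ q → bit (lookup E q) * r q a) a))) ⟩
    Perms.total (λ a → sum (λ q → bit (lookup E q) * r q a))
      ≡⟨ sym (∑-comm {n} (λ q t → bit (lookup E q) * r q (Perms.enum t))) ⟩
    sum (λ q → Perms.total (λ a → bit (lookup E q) * r q a))
      ≡⟨ sum-cong-≗ {n} (λ q → sym (*-distribˡ-sum (bit (lookup E q)) (λ t → r q (Perms.enum t)))) ⟩
    sum (λ q → bit (lookup E q) * entry D (E [ q ]≔ false)) ∎
    where
    open ≡-Reasoning
    l r : Fin n → Perm n → ℕ
    l p a = w a * 𝟙 (maps? a (D [ p ]≔ true) E)
    r q a = w a * 𝟙 (maps? a D (E [ q ]≔ false))
    no-map : ∀ a D E p → lookup D p ≢ lookup E (a ⟨$⟩ʳ p) → w a * 𝟙 (maps? a D E) ≡ 0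
    no-map a D E p ≢ = trans (cong (w a *_) (𝟙-false (maps? a D E) (λ m → ≢ (sym (at m p))))) (*-zeroʳ (w a))
    pointwise : ∀ a p → bit (not (lookup D p)) * l p a ≡ bit (lookup E (a ⟨$⟩ʳ p)) * r (a ⟨$⟩ʳ p) a
    pointwise a p with lookup D p in p∈D? | lookup E (a ⟨$⟩ʳ p) in ap∈E?
    ... | true  | false = refl
    ... | true  | true  = sym (trans (+-identityʳ _) (no-map a D _ p
            λ eq → case trans (sym p∈D?) (trans eq (lookup-≔ E _ false)) of λ ()))
    ... | false | false = trans (+-identityʳ _) (no-map a _ E p
            λ eq → case trans (sym (lookup-≔ D p true)) (trans eq ap∈E?) of λ ())
    ... | false | true  = cong (λ m → w a * m + 0)
            (𝟙-cong (maps? a (D [ p ]≔ true) E) (maps? a D (E [ a ⟨$⟩ʳ p ]≔ false)) to from)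
      where
      to : Maps a (D [ p ]≔ true) E → Maps a D (E [ a ⟨$⟩ʳ p ]≔ false)
      to m = mk to′
        where
        to′ : ∀ q → lookup (E [ a ⟨$⟩ʳ p ]≔ false) (a ⟨$⟩ʳ q) ≡ lookup D q
        to′ q with q Finₚ.≟ p
        ... | yes refl = trans (lookup-≔ E _ false) (sym p∈D?)
        ... | no q≢p = trans (lookup-≔-≢ E false (λ eq → q≢p (trans (sym (inverseˡ a)) (trans (cong (a ⟨$⟩ˡ_) eq) (inverseˡ a)))))
                       (trans (at m q) (lookup-≔-≢ D true q≢p))
      from : Maps a D (E [ a ⟨$⟩ʳ p ]≔ false) → Maps a (D [ p ]≔ true) E
      from m = mk from′
        where
        from′ : ∀ q → lookup E (a ⟨$⟩ʳ q) ≡ lookup (D [ p ]≔ true) q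
        from′ q with q Finₚ.≟ p
        ... | yes refl = trans ap∈E? (sym (lookup-≔ D p true))
        ... | no q≢p = trans (sym (lookup-≔-≢ E false (λ eq → q≢p (trans (sym (inverseˡ a)) (trans (cong (a ⟨$⟩ˡ_) eq) (inverseˡ a))))))
                       (trans (at m q) (sym (lookup-≔-≢ D true q≢p)))

  -- After exchanging the sums, each `a` contributes `w a` once: its only target is `image a D`,
  -- which has the right size.
  row-sum : ∀ D → Subsets.total (λ E → 𝟙 (card E ≟ card D) * entry D E) ≡ weight
  row-sum D = begin
    Subsets.total (λ E → 𝟙 (card E ≟ card D) * entry D E)
      ≡⟨ Subsets.total-cong {f = λ E → 𝟙 (card E ≟ card D) * entry D E} (λ E → *-distribˡ-sum (𝟙 (card E ≟ card D)) (λ t → w (Perms.enum t) * 𝟙 (maps? (Perms.enum t) D E))) ⟩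
    Subsets.total (λ E → Perms.total (λ a → c a E))
      ≡⟨ ∑-comm (λ s t → c (Perms.enum t) (Subsets.enum s)) ⟩
    Perms.total (λ a → Subsets.total (c a))
      ≡⟨ Perms.total-cong {g = w} (λ a → trans (Subsets.total-single (c a) (cong (c a)) (image a D) (off a)) (on a)) ⟩
    weight ∎
    where
    open ≡-Reasoning
    c : Perm n → Subset n → ℕ
    c a E = 𝟙 (card E ≟ card D) * (w a * 𝟙 (maps? a D E))
    off : ∀ a E → E ≢ image a D → c a E ≡ 0
    off a E E≢ = trans (cong (λ m → 𝟙 (card E ≟ card D) * (w a * m)) (𝟙-false (maps? a D E) (E≢ ∘ maps⇒image a)))
      (trans (cong (𝟙 (card E ≟ card D) *_) (*-zeroʳ (w a))) (*-zeroʳ (𝟙 (card E ≟ card D))))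
    on : ∀ a → c a (image a D) ≡ w a
    on a = trans (cong₂ (λ u m → u * (w a * m))
      (𝟙-true (card (image a D) ≟ card D) (sym (maps-card a (maps-image a D))))
      (𝟙-true (maps? a D (image a D)) (maps-image a D)))
      (trans (*-identityˡ _) (*-identityʳ (w a)))

  trace : ∀ i → Subsets.total (λ T → 𝟙 (card T ≟ i) * entry T T) ≡ Perms.total (λ a → w a * fixedCount i a)
  trace i = begin
    Subsets.total (λ T → 𝟙 (card T ≟ i) * entry T T)
      ≡⟨ Subsets.total-cong {f = λ E → 𝟙 (card E ≟ i) * entry E E} (λ T → *-distribˡ-sum (𝟙 (card T ≟ i)) (λ t → w (Perms.enum t) * 𝟙 (maps? (Perms.enum t) T T))) ⟩
    Subsets.total (λ T → Perms.total (λ a → 𝟙 (card T ≟ i) * (w a * 𝟙 (maps? a T T))))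
      ≡⟨ ∑-comm (λ s t → 𝟙 (card (Subsets.enum {n} s) ≟ i) * (w (Perms.enum t) * 𝟙 (maps? (Perms.enum t) (Subsets.enum s) (Subsets.enum s)))) ⟩
    Perms.total (λ a → Subsets.total (λ T → 𝟙 (card T ≟ i) * (w a * 𝟙 (maps? a T T))))
      ≡⟨ Perms.total-cong {g = λ a → w a * fixedCount i a} (λ a → trans
           (Subsets.total-cong {g = λ T → w a * 𝟙 ((card T ≟ i) ×-dec maps? a T T)} (λ T → rearrange a T))
           (sym (*-distribˡ-sum (w a) (λ s → 𝟙 ((card (Subsets.enum {n} s) ≟ i) ×-dec maps? a (Subsets.enum s) (Subsets.enum s)))))) ⟩
    Perms.total (λ a → w a * fixedCount i a) ∎
    where
    open ≡-Reasoning
    rearrange : ∀ a T → 𝟙 (card T ≟ i) * (w a * 𝟙 (maps? a T T)) ≡ w a * 𝟙 ((card T ≟ i) ×-dec maps? a T T)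
    rearrange a T = trans (sym (*-assoc (𝟙 (card T ≟ i)) (w a) _))
      (trans (cong (_* 𝟙 (maps? a T T)) (*-comm (𝟙 (card T ≟ i)) (w a)))
        (trans (*-assoc (w a) _ _) (cong (w a *_) (sym (𝟙-× (card T ≟ i) (maps? a T T))))))

fixedCount-conj : ∀ {n} i (h a : Perm n) → fixedCount i (conj h a) ≡ fixedCount i a
fixedCount-conj i h a = trans
  (Subsets.total-reindex f (cong f) (image h) (image (flip h)) (cong (image h)) (cong (image (flip h))) (inv h) (inv (flip h)))
  (Subsets.total-cong {f = f ∘ image h} (λ T → 𝟙-cong
    ((card (image h T) ≟ i) ×-dec maps? (conj h a) (image h T) (image h T))
    ((card T ≟ i) ×-dec maps? a T T)
    (λ (c , m) → trans (maps-card h (maps-image h T)) c , maps-conj⁻ h a (maps-image h T) (maps-image h T) m)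
    (λ (c , m) → trans (sym (maps-card h (maps-image h T))) c , maps-conj h a (maps-image h T) (maps-image h T) m)))
  where
  f : Subset _ → ℕ
  f T = 𝟙 ((card T ≟ i) ×-dec maps? (conj h a) T T)
  inv : ∀ h T → image h (image (flip h) T) ≡ T
  inv h T = sym (maps⇒image h {image (flip h) T} (mk λ p → sym (Vecₚ.lookup∘tabulate _ p)))

-- Constancy on i-sets

-- Evaluates one side of `exchange` in both inductions: neighbours of one kind have the value known
-- by induction, those of the other kind have the value that is sought. The factor `m` clears the
-- denominator of the average.
two-values : ∀ {n} (u v : Fin n → Bool) (g : Fin n → ℕ) m {a b} →
  (∀ q → u q ≡ true → v q ≡ true → m * g q ≡ a) →
  (∀ q → u q ≡ true → v q ≡ false → m * g q ≡ b) →
  m * sum (λ q → bit (u q) * g q) ≡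
  sum (λ q → bit (u q) * bit (v q)) * a + sum (λ q → bit (u q) * bit (not (v q))) * b
two-values {n} u v g m {a} {b} ga gb = begin
  m * sum (λ q → bit (u q) * g q)
    ≡⟨ *-distribˡ-sum m (λ q → bit (u q) * g q) ⟩
  sum (λ q → m * (bit (u q) * g q))
    ≡⟨ sum-cong-≗ pointwise ⟩
  sum (λ q → x q * a + y q * b)
    ≡⟨ ∑-distrib-+ (λ q → x q * a) (λ q → y q * b) ⟩
  sum (λ q → x q * a) + sum (λ q → y q * b)
    ≡⟨ cong₂ _+_ (sym (*-distribʳ-sum a x)) (sym (*-distribʳ-sum b y)) ⟩
  sum x * a + sum y * b ∎
  where
  open ≡-Reasoning
  x y : Fin n → ℕ
  x q = bit (u q) * bit (v q)
  y q = bit (u q) * bit (not (v q))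
  pointwise : ∀ q → m * (bit (u q) * g q) ≡ x q * a + y q * b
  pointwise q with u q | v q | ga q | gb q
  ... | false | _     | _ | _ = *-zeroʳ m
  ... | true  | true  | h | _ = trans (cong (m *_) (*-identityˡ (g q))) (trans (h refl refl) (sym (trans (+-identityʳ _) (*-identityˡ a))))
  ... | true  | false | _ | h = trans (cong (m *_) (*-identityˡ (g q))) (trans (h refl refl) (sym (*-identityˡ b)))

sum-weighted-const : ∀ {n} (u : Fin n → Bool) (g : Fin n → ℕ) {c} →
  (∀ q → u q ≡ true → g q ≡ c) → sum (λ q → bit (u q) * g q) ≡ sum (bit ∘ u) * c
sum-weighted-const u g {c} gc = trans (sum-cong-≗ pointwise) (sym (*-distribʳ-sum c (bit ∘ u)))
  where
  pointwise : ∀ q → bit (u q) * g q ≡ bit (u q) * c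
  pointwise q with u q | gc q
  ... | false | _ = refl
  ... | true  | h = cong (_+ 0) (h refl)

-- If a weighted mean of `w` and `z` is already `w`, then `z` cannot differ, provided that it has
-- positive weight. Each induction step ends here, and its work lies in finding a neighbour that
-- makes `b` positive.
mixed-cancel : ∀ {a b w z} → a * w + b * z ≡ (a + b) * w → 1 ≤ b → z ≡ w
mixed-cancel {a} {suc b} {w} {z} eq _ = *-cancelˡ-≡ z w (suc b)
  (+-cancelˡ-≡ (a * w) _ _ (trans eq (*-distribʳ-+ w a (suc b))))

not-true⇒false : ∀ {b} → not b ≡ true → b ≡ false
not-true⇒false {false} _ = refl

coCard : ∀ {n} → Subset n → ℕ
coCard T = sum (λ p → bit (not (lookup T p)))

coCard+card : ∀ {n} (T : Subset n) → coCard T + card T ≡ n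
coCard+card {n} T = trans (sym (∑-distrib-+ (λ p → bit (not (lookup T p))) (bit ∘ lookup T)))
  (trans (sum-cong-≗ (λ p → pointwise (lookup T p))) (trans (sum-const n 1) (*-identityʳ n)))
  where
  pointwise : ∀ b → bit (not b) + bit b ≡ 1
  pointwise true  = refl
  pointwise false = refl

coCard-∸ : ∀ {n i} (T : Subset n) → card T ≡ i → coCard T ≡ n ∸ i
coCard-∸ {n} T refl = sym (trans (cong (_∸ card T) (sym (coCard+card T))) (m+n∸n≡m (coCard T) (card T)))

-- `total-reindex` demands a bijection of all subsets, which neither inserting nor removing a point
-- is. Toggling is an involution and does both.
toggle : ∀ {n} → Fin n → Subset n → Subset n
toggle p T = T [ p ]≔ not (lookup T p)

toggle-involutive : ∀ {n} (p : Fin n) T → toggle p (toggle p T) ≡ T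
toggle-involutive p T = subset-ext pointwise
  where
  pointwise : ∀ q → lookup (toggle p (toggle p T)) q ≡ lookup T q
  pointwise q with q Finₚ.≟ p
  ... | yes refl = trans (lookup-≔ (toggle p T) p _) (trans (cong not (lookup-≔ T p _)) (Boolₚ.not-involutive (lookup T p)))
  ... | no q≢p = trans (lookup-≔-≢ (toggle p T) _ q≢p) (lookup-≔-≢ T _ q≢p)

-- Counts pairs T ⊂ T ∪ {p} with |T| = i in two ways.
flag-count : ∀ n i → (n ∸ i) * subsetCount n i ≡ suc i * subsetCount n (suc i)
flag-count n i = begin
  (n ∸ i) * subsetCount n i
    ≡⟨ *-distribˡ-sum (n ∸ i) (λ t → 𝟙 (card (Subsets.enum {n} t) ≟ i)) ⟩
  Subsets.total {n} (λ T → (n ∸ i) * 𝟙 (card T ≟ i))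
    ≡⟨ Subsets.total-cong {n} {g = λ T → sum (λ p → l p T)} (λ T → trans (left T) (*-distribˡ-sum (𝟙 (card T ≟ i)) (λ p → bit (not (lookup T p))))) ⟩
  Subsets.total {n} (λ T → sum (λ p → l p T))
    ≡⟨ ∑-comm (λ t p → l p (Subsets.enum t)) ⟩
  sum (λ p → Subsets.total (l p))
    ≡⟨ sum-cong-≗ swap ⟩
  sum (λ p → Subsets.total (r p))
    ≡⟨ sym (∑-comm (λ t p → r p (Subsets.enum t))) ⟩
  Subsets.total {n} (λ T → sum (λ p → r p T))
    ≡⟨ sym (Subsets.total-cong {n} {f = λ T → suc i * 𝟙 (card T ≟ suc i)} (λ T → trans (right T) (*-distribˡ-sum (𝟙 (card T ≟ suc i)) (bit ∘ lookup T)))) ⟩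
  Subsets.total {n} (λ T → suc i * 𝟙 (card T ≟ suc i))
    ≡⟨ sym (*-distribˡ-sum (suc i) (λ t → 𝟙 (card (Subsets.enum {n} t) ≟ suc i))) ⟩
  suc i * subsetCount n (suc i) ∎
  where
  open ≡-Reasoning
  l r : Fin n → Subset n → ℕ
  l p T = 𝟙 (card T ≟ i) * bit (not (lookup T p))
  r p T = 𝟙 (card T ≟ suc i) * bit (lookup T p)
  left : ∀ T → (n ∸ i) * 𝟙 (card T ≟ i) ≡ 𝟙 (card T ≟ i) * coCard T
  left T with card T ≟ i
  ... | yes eq = trans (*-identityʳ _) (sym (trans (*-identityˡ _) (coCard-∸ T eq)))
  ... | no _   = *-zeroʳ (n ∸ i)
  right : ∀ T → suc i * 𝟙 (card T ≟ suc i) ≡ 𝟙 (card T ≟ suc i) * card T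
  right T with card T ≟ suc i
  ... | yes eq = trans (*-identityʳ _) (sym (trans (*-identityˡ _) eq))
  ... | no _   = *-zeroʳ (suc i)
  toggled : ∀ p T → l p (toggle p T) ≡ r p T
  toggled p T with lookup T p in p∈T?
  ... | true = begin
    𝟙 (card (T [ p ]≔ false) ≟ i) * bit (not (lookup (T [ p ]≔ false) p))
      ≡⟨ cong₂ (λ a b → a * bit (not b)) (𝟙-cong (card (T [ p ]≔ false) ≟ i) (card T ≟ suc i)
          (λ eq → trans (sym (card-remove T p p∈T?)) (cong suc eq))
          (λ eq → suc-injective (trans (card-remove T p p∈T?) eq))) (lookup-≔ T p false) ⟩
    𝟙 (card T ≟ suc i) * 1 ∎
  ... | false = trans (cong (λ b → 𝟙 (card (T [ p ]≔ true) ≟ i) * bit (not b)) (lookup-≔ T p true))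
    (trans (*-zeroʳ (𝟙 (card (T [ p ]≔ true) ≟ i))) (sym (*-zeroʳ (𝟙 (card T ≟ suc i)))))
  swap : ∀ p → Subsets.total (l p) ≡ Subsets.total (r p)
  swap p = trans
    (Subsets.total-reindex (l p) (cong (l p)) (toggle p) (toggle p) (cong (toggle p)) (cong (toggle p))
      (toggle-involutive p) (toggle-involutive p))
    (Subsets.total-cong {n} {f = l p ∘ toggle p} {g = r p} (toggled p))

initial : ∀ n → ℕ → Subset n
initial n k = tabulate (λ p → does (toℕ p <? k))

card-initial : ∀ n k → k ≤ n → card (initial n k) ≡ k
card-initial n k k≤n = trans (sum-cong-≗ {n} (λ p → cong bit (Vecₚ.lookup∘tabulate (λ p → does (toℕ p <? k)) p))) (go n k k≤n)
  where
  go : ∀ n k → k ≤ n → sum {n} (λ p → bit (does (toℕ p <? k))) ≡ k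
  go zero    zero    _         = refl
  go (suc n) zero    _         = sum-zero {n} _ (λ _ → refl)
  go (suc n) (suc k) (s≤s k≤n) = cong suc (go n k k≤n)

module Propagation {n} (w : Perm n → ℕ) (w-cong : ∀ {a b} → a ≈ₚ b → w a ≡ w b)
  (w-conj : ∀ h a → w (conj h a) ≡ w a) where

  open ClassFunction w w-cong w-conj

  Const : ℕ → ℕ → Set
  Const i c = ∀ D E → card D ≡ i → card E ≡ i → entry D E ≡ c

  const-zero : Const 0 (entry (initial n 0) (initial n 0))
  const-zero D E cD cE = entry-meet (trans cD (sym c₀)) (trans cE (sym c₀))
    (trans (meet0 D E cD) (sym (meet0 (initial n 0) (initial n 0) c₀)))
    where
    c₀ = card-initial n 0 z≤n
    meet0 : ∀ (D E : Subset n) → card D ≡ 0 → meet D E ≡ 0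
    meet0 D E cD = m+n≡0⇒n≡0 (sum (λ p → bit (lookup D p) * bit (not (lookup E p)))) (trans (sum-split D E) cD)

  -- By the row sum, a constant value can only be the average: `weight` divided by the number of
  -- i-sets.
  const-row : ∀ {i c} → i ≤ n → Const i c → subsetCount n i * c ≡ weight
  const-row {i} {c} i≤n const = begin
    subsetCount n i * c
      ≡⟨ *-distribʳ-sum c (λ t → 𝟙 (card (Subsets.enum {n} t) ≟ i)) ⟩
    Subsets.total {n} (λ E → 𝟙 (card E ≟ i) * c)
      ≡⟨ Subsets.total-cong {n} {f = λ E → 𝟙 (card E ≟ i) * c} pointwise ⟩
    Subsets.total {n} (λ E → 𝟙 (card E ≟ card D₀) * entry D₀ E)
      ≡⟨ row-sum D₀ ⟩
    weight ∎
    where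
    open ≡-Reasoning
    D₀ = initial n i
    pointwise : ∀ E → 𝟙 (card E ≟ i) * c ≡ 𝟙 (card E ≟ card D₀) * entry D₀ E
    pointwise E rewrite card-initial n i i≤n with card E ≟ i
    ... | yes cE = cong (_+ 0) (sym (const D₀ E (card-initial n i i≤n) cE))
    ... | no _   = refl

  -- Assumes constancy on the diagonal only, since `const-up` needs it before anything is known off
  -- the diagonal.
  const-trace : ∀ {i c} → (∀ T → card T ≡ i → entry T T ≡ c) →
    Subsets.total {n} (λ T → 𝟙 (card T ≟ i) * entry T T) ≡ subsetCount n i * c
  const-trace {i} {c} diag = trans
    (Subsets.total-cong {n} {f = λ T → 𝟙 (card T ≟ i) * entry T T} pointwise)
    (sym (*-distribʳ-sum c (λ t → 𝟙 (card (Subsets.enum {n} t) ≟ i))))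
    where
    pointwise : ∀ T → 𝟙 (card T ≟ i) * entry T T ≡ 𝟙 (card T ≟ i) * c
    pointwise T with card T ≟ i
    ... | yes cT = cong (_+ 0) (diag T cT)
    ... | no _   = refl

  -- Induction on s = |D ∩ E|. Enlarge `E` to `Γ` by a point `p` outside both sets and apply
  -- `exchange` to `D` and `Γ`. The left side involves only (i+1)-sets against (i+1)-sets, hence is
  -- known. On the right, removing `q` from `Γ` leaves an i-set that meets `D` in s - 1 points if
  -- `q` is in `D`, and in s points otherwise; the latter entries equal `entry D E`.
  const-down : ∀ {i r} → i + i < n → Const (suc i) r → ∃[ c ] Const i c
  const-down {i} {r} 2i<n const = entry D₀ D₀ , λ D E cD cE →
    *-cancelˡ-≡ _ _ (suc i) (trans (claim _ D E cD cE refl) (sym (claim _ D₀ D₀ cD₀ cD₀ refl)))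
    where
    D₀ = initial n i
    cD₀ = card-initial n i (≤-trans (m≤m+n i i) (<⇒≤ 2i<n))
    -- The left side of `exchange`: each of the n - i points outside `D` contributes `r`. The right
    -- side has i + 1 terms, so the common value is `C` divided by i + 1.
    C = (n ∸ i) * r
    Claim : ℕ → Set
    Claim s = ∀ D E → card D ≡ i → card E ≡ i → meet D E ≡ s → suc i * entry D E ≡ C
    -- Stated through the predecessor so that s = 0 needs no separate argument: then no `q` of `Γ`
    -- lies in `D`, and `ih` is vacuous.
    step : ∀ s → (∀ s′ → suc s′ ≡ s → Claim s′) → Claim s
    step s ih D E cD cE mDE = mixed-cancel {meet Γ D} {onlyΓ} (begin
      meet Γ D * C + onlyΓ * (suc i * entry D E)
        ≡⟨ sym (two-values (lookup Γ) (lookup D) (λ q → entry D (Γ [ q ]≔ false)) (suc i) inside outside) ⟩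
      suc i * sum (λ q → bit (lookup Γ q) * entry D (Γ [ q ]≔ false))
        ≡⟨ cong (suc i *_) (sym (exchange D Γ)) ⟩
      suc i * sum (λ p → bit (not (lookup D p)) * entry (D [ p ]≔ true) Γ)
        ≡⟨ cong (suc i *_) (sum-weighted-const (λ p → not (lookup D p)) (λ p → entry (D [ p ]≔ true) Γ)
             (λ p p∉D → const (D [ p ]≔ true) Γ (trans (card-insert D p (not-true⇒false p∉D)) (cong suc cD)) cΓ)) ⟩
      suc i * (coCard D * r)
        ≡⟨ cong₂ (λ a b → a * (b * r)) (sym (trans (+-comm (meet Γ D) onlyΓ) (trans (sum-split Γ D) cΓ))) (coCard-∸ D cD) ⟩
      (meet Γ D + onlyΓ) * C ∎)
      -- The unknown value has positive weight because `p` itself lies in `Γ` and not in `D`.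
      (≤-trans (≤-reflexive (sym (cong₂ (λ b c → bit b * bit (not c)) (lookup-≔ E p true) p∉D)))
        (f≤sum (λ q → bit (lookup Γ q) * bit (not (lookup D q))) p))
      where
      open ≡-Reasoning
      both : ∀ {b c} → 1 ≤ bit (not b) * bit (not c) → b ≡ false × c ≡ false
      both {false} {false} _ = refl , refl
      only≤ : sum (λ p → bit (lookup E p) * bit (not (lookup D p))) ≤ i
      only≤ = ≤-trans (m≤m+n _ (meet E D)) (≤-reflexive (trans (sum-split E D) cE))
      -- If `D` and `E` covered all points, n would be |E minus D| + |D|, which is at most 2i.
      free : ∃[ p ] 1 ≤ bit (not (lookup D p)) * bit (not (lookup E p))
      free = sum>0⇒∃ _ (n≢0⇒n>0 (λ eq → <⇒≱ 2i<n
        (≤-trans (≤-reflexive (trans (sym (sum-complement D E)) (cong (_+ (sum (λ p → bit (lookup E p) * bit (not (lookup D p))) + card D)) eq)))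
          (+-mono-≤ only≤ (≤-reflexive cD)))))
      p = proj₁ free
      p∉D = proj₁ (both (proj₂ free))
      p∉E = proj₂ (both {lookup D p} (proj₂ free))
      Γ = E [ p ]≔ true
      onlyΓ = sum (λ q → bit (lookup Γ q) * bit (not (lookup D q)))
      cΓ : card Γ ≡ suc i
      cΓ = trans (card-insert E p p∉E) (cong suc cE)
      mDΓ : meet D Γ ≡ s
      mDΓ = trans (meet-insertʳ D E p p∉E) (trans (cong (λ b → meet D E + bit b) p∉D) (trans (+-identityʳ _) mDE))
      c- : ∀ q → lookup Γ q ≡ true → card (Γ [ q ]≔ false) ≡ i
      c- q q∈Γ = suc-injective (trans (card-remove Γ q q∈Γ) cΓ)
      inside : ∀ q → lookup Γ q ≡ true → lookup D q ≡ true → suc i * entry D (Γ [ q ]≔ false) ≡ C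
      inside q q∈Γ q∈D = ih _ (trans (+-comm 1 _) (trans (cong (λ b → meet D (Γ [ q ]≔ false) + bit b) (sym q∈D))
          (trans (meet-removeʳ D Γ q q∈Γ) mDΓ)))
        D (Γ [ q ]≔ false) cD (c- q q∈Γ) refl
      outside : ∀ q → lookup Γ q ≡ true → lookup D q ≡ false → suc i * entry D (Γ [ q ]≔ false) ≡ suc i * entry D E
      outside q q∈Γ q∉D = cong (suc i *_) (entry-meet refl (trans (c- q q∈Γ) (sym cE))
        (trans (sym (+-identityʳ _)) (trans (cong (λ b → meet D (Γ [ q ]≔ false) + bit b) (sym q∉D))
          (trans (meet-removeʳ D Γ q q∈Γ) (trans mDΓ (sym mDE))))))
    claim : ∀ s → Claim s
    claim zero    = step zero (λ _ ())
    claim (suc s) = step (suc s) (λ { _ refl → claim s })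

  -- Induction on t = |D| - |D ∩ E|, away from the diagonal. For t > 0 remove from `D` a point `p`
  -- outside `E` and apply `exchange` to the resulting `D′` and `E`. Now the right side involves
  -- only i-sets and is known. On the left, adding `q` to `D′` gives a set closer to `E` if `q` is
  -- in `E`, and otherwise one with the same intersection size as `D`.
  const-up : ∀ {i c} → suc i ≤ n → 1 ≤ weight → Const i c →
    Subsets.total {n} (λ T → 𝟙 (card T ≟ suc i) * entry T T) ≡ weight → ∃[ c′ ] Const (suc i) c′
  const-up {i} {c} i<n 1≤w const tr = entry D₀ D₀ , λ D E cD cE →
    *-cancelˡ-≡ _ _ b {{>-nonZero b>0}} (trans (claim′ D E cD cE) (sym (claim′ D₀ D₀ cD₀ cD₀)))
    where
    D₀ = initial n (suc i)
    cD₀ = card-initial n (suc i) i<n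
    b = subsetCount n (suc i)
    -- Diagonal entries agree with one another by `entry-meet`, so the trace hypothesis makes each
    -- of them the average.
    diag : ∀ D → card D ≡ suc i → b * entry D D ≡ weight
    diag D cD = trans (sym (const-trace (λ T cT → entry-meet (trans cT (sym cD)) (trans cT (sym cD))
      (trans (meet-self T) (trans cT (trans (sym cD) (sym (meet-self D)))))))) tr
    b>0 : 1 ≤ b
    b>0 = n≢0⇒n>0 (λ b≡0 → <⇒≢ 1≤w (trans (sym (cong (_* entry D₀ D₀) b≡0)) (diag D₀ cD₀)))
    Claim : ℕ → Set
    Claim t = ∀ D E → card D ≡ suc i → card E ≡ suc i → t + meet D E ≡ suc i → b * entry D E ≡ weight
    claim : ∀ t → Claim t
    claim zero D E cD cE mDE = trans (cong (b *_) (entry-meet refl (trans cE (sym cD))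
      (trans mDE (sym (trans (meet-self D) cD))))) (diag D cD)
    claim (suc t) D E cD cE mDE = mixed-cancel {in-E} {out-E} (begin
      in-E * weight + out-E * (b * entry D E)
        ≡⟨ sym (two-values (λ q → not (lookup D′ q)) (lookup E) (λ q → entry (D′ [ q ]≔ true) E) b inside outside) ⟩
      b * sum (λ q → bit (not (lookup D′ q)) * entry (D′ [ q ]≔ true) E)
        ≡⟨ cong (b *_) (exchange D′ E) ⟩
      b * sum (λ q → bit (lookup E q) * entry D′ (E [ q ]≔ false))
        ≡⟨ cong (b *_) (sum-weighted-const (lookup E) (λ q → entry D′ (E [ q ]≔ false))
             (λ q q∈E → const D′ (E [ q ]≔ false) cD′ (suc-injective (trans (card-remove E q q∈E) cE)))) ⟩
      b * (card E * c)
        ≡⟨ cong (λ e → b * (e * c)) cE ⟩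
      b * (suc i * c)
        ≡⟨ sym (*-assoc b (suc i) c) ⟩
      b * suc i * c
        -- `flag-count` trades the number of (i+1)-sets for that of i-sets, where `const-row` turns
        -- `c` into `weight`. The result is one average for each of the n - i points outside `D′`.
        ≡⟨ cong (_* c) (trans (*-comm b (suc i)) (sym (flag-count n i))) ⟩
      (n ∸ i) * subsetCount n i * c
        ≡⟨ *-assoc (n ∸ i) (subsetCount n i) c ⟩
      (n ∸ i) * (subsetCount n i * c)
        ≡⟨ cong₂ _*_ (trans (sym (coCard-∸ D′ cD′)) co-split) (const-row (<⇒≤ i<n) const) ⟩
      (in-E + out-E) * weight ∎)
      -- The removed point `p` is outside both `D′` and `E`, so it is counted in `out-E`.
      (≤-trans (≤-reflexive (sym (cong₂ (λ b c → bit (not b) * bit (not c)) (lookup-≔ D p false) p∉E)))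
        (f≤sum (λ q → bit (not (lookup D′ q)) * bit (not (lookup E q))) p))
      where
      open ≡-Reasoning
      both : ∀ {b c} → 1 ≤ bit b * bit (not c) → b ≡ true × c ≡ false
      both {true} {false} _ = refl , refl
      excess : ∃[ p ] 1 ≤ bit (lookup D p) * bit (not (lookup E p))
      excess = sum>0⇒∃ _ (subst (1 ≤_) (+-cancelʳ-≡ (meet D E) _ _ (trans mDE (sym (trans (sum-split D E) cD)))) (s≤s z≤n))
      p = proj₁ excess
      p∈D = proj₁ (both {lookup D p} {lookup E p} (proj₂ excess))
      p∉E = proj₂ (both {lookup D p} {lookup E p} (proj₂ excess))
      D′ = D [ p ]≔ false
      in-E out-E : ℕ
      in-E  = sum (λ q → bit (not (lookup D′ q)) * bit (lookup E q))
      out-E = sum (λ q → bit (not (lookup D′ q)) * bit (not (lookup E q)))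
      cD′ : card D′ ≡ i
      cD′ = suc-injective (trans (card-remove D p p∈D) cD)
      mD′E : meet D′ E ≡ meet D E
      mD′E = trans (sym (+-identityʳ _)) (trans (cong (λ b → meet D′ E + bit b) (sym p∉E)) (meet-removeˡ D E p p∈D))
      co-split : coCard D′ ≡ in-E + out-E
      co-split = trans (sum-cong-≗ (λ q → pointwise (not (lookup D′ q)) (lookup E q)))
        (∑-distrib-+ (λ q → bit (not (lookup D′ q)) * bit (lookup E q)) (λ q → bit (not (lookup D′ q)) * bit (not (lookup E q))))
        where
        pointwise : ∀ b c → bit b ≡ bit b * bit c + bit b * bit (not c)
        pointwise true  true  = refl
        pointwise true  false = refl
        pointwise false _     = refl
      c+ : ∀ q → not (lookup D′ q) ≡ true → card (D′ [ q ]≔ true) ≡ suc i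
      c+ q q∉D′ = trans (card-insert D′ q (not-true⇒false q∉D′)) (cong suc cD′)
      m+ : ∀ q → not (lookup D′ q) ≡ true → meet (D′ [ q ]≔ true) E ≡ meet D E + bit (lookup E q)
      m+ q q∉D′ = trans (meet-insertˡ D′ E q (not-true⇒false q∉D′)) (cong (_+ bit (lookup E q)) mD′E)
      inside : ∀ q → not (lookup D′ q) ≡ true → lookup E q ≡ true → b * entry (D′ [ q ]≔ true) E ≡ weight
      inside q q∉D′ q∈E = claim t (D′ [ q ]≔ true) E (c+ q q∉D′) cE
        (trans (cong (t +_) (trans (m+ q q∉D′) (trans (cong (λ b → meet D E + bit b) q∈E) (+-comm (meet D E) 1))))
          (trans (+-suc t (meet D E)) mDE))
      outside : ∀ q → not (lookup D′ q) ≡ true → lookup E q ≡ false → b * entry (D′ [ q ]≔ true) E ≡ b * entry D E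
      outside q q∉D′ q∉E = cong (b *_) (entry-meet (trans (c+ q q∉D′) (sym cD)) refl
        (trans (m+ q q∉D′) (trans (cong (λ b → meet D E + bit b) q∉E) (+-identityʳ _))))
    claim′ : ∀ D E → card D ≡ suc i → card E ≡ suc i → b * entry D E ≡ weight
    claim′ D E cD cE = claim (suc i ∸ meet D E) D E cD cE (m∸n+n≡m
      (≤-trans (m≤n+m (meet D E) (sum (λ p → bit (lookup D p) * bit (not (lookup E p))))) (≤-reflexive (trans (sum-split D E) cD))))

-- Codes and fixed subsets

class-cong : ∀ {n} (x a b : Perm n) → a ≈ₚ b → ConjClass x a → ConjClass x b
class-cong x a b eq (h , spec) = h , λ i → trans (sym (eq _)) (spec i)

class-conj : ∀ {n} (x g a : Perm n) → ConjClass x a → ConjClass x (conj g a)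
class-conj x g a (h , spec) = h ∘ₚ g , λ i → cong (g ⟨$⟩ʳ_) (trans (cong (a ⟨$⟩ʳ_) (inverseˡ g)) (spec i))

class-conj⁻ : ∀ {n} (x g a : Perm n) → ConjClass x (conj g a) → ConjClass x a
class-conj⁻ x g a c = class-cong x (conj (flip g) (conj g a)) a (flip-conj g a) (class-conj x (flip g) (conj g a) c)

class? : ∀ {n} (x a : Perm n) → Dec (ConjClass x a)
class? x a = Perms.any-dec (λ h → Finₚ.all? (λ i → (a ⟨$⟩ʳ (h ⟨$⟩ʳ i)) Finₚ.≟ (h ⟨$⟩ʳ (x ⟨$⟩ʳ i))))
  (λ eq spec i → trans (cong (a ⟨$⟩ʳ_) (sym (eq i))) (trans (spec i) (eq _)))

fixedCount-cong : ∀ {n} i (a b : Perm n) → a ≈ₚ b → fixedCount i a ≡ fixedCount i b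
fixedCount-cong {n} i a b eq = Subsets.total-cong {n} {λ T → 𝟙 ((card T ≟ i) ×-dec maps? a T T)} (λ T → 𝟙-cong
  ((card T ≟ i) ×-dec maps? a T T) ((card T ≟ i) ×-dec maps? b T T)
  (λ (c , m) → c , maps-cong a b eq m) (λ (c , m) → c , maps-cong b a (sym ∘ eq) m))

fixedCount-class : ∀ {n} i (x a : Perm n) → ConjClass x a → fixedCount i a ≡ fixedCount i x
fixedCount-class i x a (h , spec) = trans
  (fixedCount-cong i a (conj h x) (λ j → trans (cong (a ⟨$⟩ʳ_) (sym (inverseʳ h))) (spec (h ⟨$⟩ˡ j))))
  (fixedCount-conj i h x)

lookup-initial : ∀ {n} k (p : Fin n) → lookup (initial n k) p ≡ does (toℕ p <? k)
lookup-initial k p = Vecₚ.lookup∘tabulate (λ p → does (toℕ p <? k)) p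

young⇒maps : ∀ {n k} (b : Perm n) → Young k b → Maps b (initial n k) (initial n k)
young⇒maps {n} {k} b y = mk λ p → trans (lookup-initial k (b ⟨$⟩ʳ p)) (trans (agree p) (sym (lookup-initial k p)))
  where
  agree : ∀ p → does (toℕ (b ⟨$⟩ʳ p) <? k) ≡ does (toℕ p <? k)
  agree p = decide (toℕ p <? k)
    where
    decide : (p<?k : Dec (toℕ p < k)) → does (toℕ (b ⟨$⟩ʳ p) <? k) ≡ does p<?k
    decide (yes p<k) = dec-true (_ <? k) (proj₁ (y p) p<k)
    decide (no p≮k)  = dec-false (_ <? k) (proj₂ (y p) p≮k)

maps⇒young : ∀ {n k} (b : Perm n) → Maps b (initial n k) (initial n k) → Young k b
maps⇒young {n} {k} b m i =
  (λ i<k → does-true⇒ (_ <? k) (trans agree (dec-true (_ <? k) i<k))) ,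
  (λ i≮k bi<k → i≮k (does-true⇒ (_ <? k) (trans (sym agree) (dec-true (_ <? k) bi<k))))
  where
  agree : does (toℕ (b ⟨$⟩ʳ i) <? k) ≡ does (toℕ i <? k)
  agree = trans (sym (lookup-initial k (b ⟨$⟩ʳ i))) (trans (at m i) (lookup-initial k i))

module Code {n} (x : Perm n) where

  w : Perm n → ℕ
  w a = 𝟙 (class? x a)

  w-cong : ∀ {a b} → a ≈ₚ b → w a ≡ w b
  w-cong {a} {b} eq = 𝟙-cong (class? x a) (class? x b) (class-cong x a b eq) (class-cong x b a (sym ∘ eq))

  w-conj : ∀ h a → w (conj h a) ≡ w a
  w-conj h a = 𝟙-cong (class? x (conj h a)) (class? x a) (class-conj⁻ x h a) (class-conj x h a)

  open ClassFunction w (λ {a} {b} → w-cong {a} {b}) w-conj public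
  open Propagation w (λ {a} {b} → w-cong {a} {b}) w-conj public

  weight>0 : 1 ≤ weight
  weight>0 = ≤-trans (≤-reflexive (sym (𝟙-true (class? x (Perms.enum (Perms.index x))) (idₚ , λ i → Perms.enum-index x i)))) (f≤sum (w ∘ Perms.enum) (Perms.index x))

  InCoset : Subset n → Subset n → Perm n → Set
  InCoset D E a = ConjClass x a × Maps a D E

  entry-card : ∀ D E → HasCard _≈ₚ_ (InCoset D E) (entry D E)
  entry-card D E = subst (HasCard _≈ₚ_ (InCoset D E))
    (Perms.total-cong {f = λ a → 𝟙 (class? x a ×-dec maps? a D E)} (λ a → 𝟙-× (class? x a) (maps? a D E)))
    (Perms.HasCard-total (λ a → class? x a ×-dec maps? a D E)
      (λ {a} {b} eq (c , m) → class-cong x a b eq c , maps-cong a b eq m))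

  module _ (k : ℕ) (g : Perm n) where

    Δ = initial n k
    Γ = image g Δ

    Factors : Perm n × Perm n → Set
    Factors p = ConjClass x (proj₁ p) × Young k (proj₂ p) × IsProd g (proj₁ p) (proj₂ p)

    -- The second factor is a⁻¹ g, as `∘ₚ` applies `g` first.
    complete : Perm n → Perm n × Perm n
    complete a = a , g ∘ₚ flip a

    factors⇒coset : ∀ p → Factors p → InCoset Δ Γ (proj₁ p)
    factors⇒coset (a , b) (c , y , prod) = c , mk λ q → begin
      lookup Γ (a ⟨$⟩ʳ q)                      ≡⟨ cong (λ q → lookup Γ (a ⟨$⟩ʳ q)) (sym (inverseʳ b)) ⟩
      lookup Γ (a ⟨$⟩ʳ (b ⟨$⟩ʳ (b ⟨$⟩ˡ q)))    ≡⟨ cong (lookup Γ) (sym (prod _)) ⟩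
      lookup Γ (g ⟨$⟩ʳ (b ⟨$⟩ˡ q))             ≡⟨ at (maps-image g Δ) _ ⟩
      lookup Δ (b ⟨$⟩ˡ q)                      ≡⟨ maps-inverse b (young⇒maps b y) q ⟩
      lookup Δ q                               ∎
      where open ≡-Reasoning

    coset⇒factors : ∀ a → InCoset Δ Γ a → Factors (complete a)
    coset⇒factors a (c , m) = c ,
      maps⇒young (g ∘ₚ flip a) (mk λ q → trans (maps-inverse a m (g ⟨$⟩ʳ q)) (at (maps-image g Δ) q)) ,
      λ i → sym (inverseʳ a)

    complete-proj₁ : ∀ p → Factors p → complete (proj₁ p) ≈² p
    complete-proj₁ (a , b) (_ , _ , prod) = (λ _ → refl) , λ i → trans (cong (a ⟨$⟩ˡ_) (prod i)) (inverseˡ a)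

    complete-cong : ∀ {a b} → a ≈ₚ b → complete a ≈² complete b
    complete-cong {a} {b} eq = eq , λ i → ⟨$⟩ˡ-cong a b eq (g ⟨$⟩ʳ i)

    ≈²-trans : {p q r : Perm n × Perm n} → p ≈² q → q ≈² r → p ≈² r
    ≈²-trans (a , b) (c , d) = (λ i → trans (a i) (c i)) , (λ i → trans (b i) (d i))

    ≈²-sym : {p q : Perm n × Perm n} → p ≈² q → q ≈² p
    ≈²-sym (a , b) = sym ∘ a , sym ∘ b

    factors-card⇒entry : ∀ {r} → HasCard _≈²_ Factors r → entry Δ Γ ≡ r
    factors-card⇒entry c = HasCard-unique (λ {a} {b} {c} → ≈ₚ-trans {π = a} {b} {c}) (λ {a} {b} → ≈ₚ-sym {π = a} {b}) (entry-card Δ Γ)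
      (HasCard-transfer (λ {a} {b} {c} → ≈²-trans {a} {b} {c}) (λ {a} {b} → ≈²-sym {a} {b})
        (λ {a} {b} {c} → ≈ₚ-trans {π = a} {b} {c}) (λ {a} {b} → ≈ₚ-sym {π = a} {b})
        proj₁ complete proj₁ (λ {a} {b} → complete-cong {a} {b}) factors⇒coset coset⇒factors complete-proj₁ (λ _ _ _ → refl) c)

    entry⇒factors-card : HasCard _≈²_ Factors (entry Δ Γ)
    entry⇒factors-card = HasCard-transfer
        (λ {a} {b} {c} → ≈ₚ-trans {π = a} {b} {c}) (λ {a} {b} → ≈ₚ-sym {π = a} {b})
        (λ {a} {b} {c} → ≈²-trans {a} {b} {c}) (λ {a} {b} → ≈²-sym {a} {b})
        complete proj₁ (λ {a} {b} → complete-cong {a} {b}) proj₁ coset⇒factors factors⇒coset (λ _ _ _ → refl) complete-proj₁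
        (entry-card Δ Γ)

  module _ {k : ℕ} (k≤n : k ≤ n) where

    -- The code condition speaks only of entries in the row of the initial segment, but all its
    -- k-subset columns are reached as images under some `g`. Any other row is moved there by an
    -- `h`, under which entries are invariant.
    code⇒const : ∀ {r} → IsCode r (ConjClass x) (Young k) → Const k r
    code⇒const code D E cD cE =
      let D₀ = initial n k
          h , hD = set-transitive D D₀ (trans cD (sym (card-initial n k k≤n)))
          hE = maps-image h E
          g , gE = set-transitive D₀ (image h E) (trans (card-initial n k k≤n) (trans (sym cE) (maps-card h hE)))
      in trans (entry-invariant h hD hE)
           (trans (cong (entry D₀) (maps⇒image g gE)) (factors-card⇒entry k g (code g)))

    const⇒code : ∀ {r} → Const k r → IsCode r (ConjClass x) (Young k)
    const⇒code const g = subst (HasCard _≈²_ (Factors k g))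
      (const (Δ k g) (Γ k g) (card-initial n k k≤n)
        (trans (sym (maps-card g (maps-image g (Δ k g)))) (card-initial n k k≤n)))
      (entry⇒factors-card k g)

  class-trace : ∀ i → Subsets.total (λ T → 𝟙 (card T ≟ i) * entry T T) ≡ weight * fixedCount i x
  class-trace i = trans (trace i) (trans
    (Perms.total-cong {f = λ a → w a * fixedCount i a} pointwise)
    (sym (*-distribʳ-sum (fixedCount i x) (w ∘ Perms.enum))))
    where
    pointwise : ∀ a → w a * fixedCount i a ≡ w a * fixedCount i x
    pointwise a with class? x a
    ... | yes c = cong (_+ 0) (fixedCount-class i x a c)
    ... | no _  = refl

  module _ {k : ℕ} (2k<n : k + k < n) where

    private
      k≤n : k ≤ n
      k≤n = ≤-trans (m≤m+n k k) (<⇒≤ 2k<n)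

    -- Constancy descends from `k` to `i`, which makes the trace on i-sets equal to `weight`.
    -- Comparison with `class-trace` cancels the positive `weight`.
    code⇒fixed : ∀ {r} → IsCode r (ConjClass x) (Young k) → ∀ i → i ≤ k → fixedCount i x ≡ 1
    code⇒fixed {r} code i i≤k = *-cancelˡ-≡ _ _ weight {{>-nonZero weight>0}} (begin
      weight * fixedCount i x                       ≡⟨ sym (class-trace i) ⟩
      Subsets.total (λ T → 𝟙 (card T ≟ i) * entry T T)    ≡⟨ const-trace (λ T cT → proj₂ const T T cT cT) ⟩
      subsetCount n i * proj₁ const                 ≡⟨ const-row (≤-trans i≤k k≤n) (proj₂ const) ⟩
      weight                                        ≡⟨ sym (*-identityʳ weight) ⟩
      weight * 1                                    ∎)
      where
      open ≡-Reasoning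
      descend : ∀ d i → d + i ≡ k → ∃[ c ] Const i c
      descend zero    i refl = r , code⇒const k≤n code
      descend (suc d) i eq   = const-down
        (≤-trans (s≤s (+-mono-≤ i≤k′ i≤k′)) 2k<n)
        (proj₂ (descend d (suc i) (trans (+-suc d i) eq)))
        where
        i≤k′ : i ≤ k
        i≤k′ = ≤-trans (m≤n+m i (suc d)) (≤-reflexive eq)
      const : ∃[ c ] Const i c
      const = descend (k ∸ i) i (m∸n+n≡m i≤k)

    fixed⇒code : (∀ i → i ≤ k → fixedCount i x ≡ 1) → ∃[ r ] (1 ≤ r × IsCode r (ConjClass x) (Young k))
    fixed⇒code fixed = proj₁ const , n≢0⇒n>0 c≢0 , const⇒code k≤n (proj₂ const)
      where
      ascend : ∀ i → i ≤ k → ∃[ c ] Const i c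
      ascend zero    _   = _ , const-zero
      ascend (suc i) i<k = const-up (≤-trans i<k k≤n) weight>0 (proj₂ (ascend i (<⇒≤ i<k)))
        (trans (class-trace (suc i)) (trans (cong (weight *_) (fixed (suc i) i<k)) (*-identityʳ weight)))
      const = ascend k ≤-refl
      c≢0 : proj₁ const ≢ 0
      c≢0 c≡0 = <⇒≢ weight>0 (sym (trans (sym (const-row k≤n (proj₂ const)))
        (trans (cong (subsetCount n k *_) c≡0) (*-zeroʳ (subsetCount n k)))))

-- Cycles

infixl 6 _∖_ _⊍_

_∖_ _⊍_ : ∀ {n} → Subset n → Subset n → Subset n
S ∖ T = zipWith (λ s t → s ∧ not t) S T
S ⊍ T = zipWith _∨_ S T

lookup-∖ : ∀ {n} (S T : Subset n) p → lookup (S ∖ T) p ≡ lookup S p ∧ not (lookup T p)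
lookup-∖ S T p = Vecₚ.lookup-zipWith _ p S T

lookup-⊍ : ∀ {n} (S T : Subset n) p → lookup (S ⊍ T) p ≡ lookup S p ∨ lookup T p
lookup-⊍ S T p = Vecₚ.lookup-zipWith _ p S T

card-∖ : ∀ {n} (S T : Subset n) → (∀ p → lookup T p ≡ true → lookup S p ≡ true) → card (S ∖ T) + card T ≡ card S
card-∖ S T T⊆S = trans (sym (∑-distrib-+ (bit ∘ lookup (S ∖ T)) (bit ∘ lookup T)))
  (sum-cong-≗ (λ p → trans (cong (λ b → bit b + bit (lookup T p)) (lookup-∖ S T p)) (pointwise p)))
  where
  pointwise : ∀ p → bit (lookup S p ∧ not (lookup T p)) + bit (lookup T p) ≡ bit (lookup S p)
  pointwise p with lookup S p | lookup T p | T⊆S p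
  ... | true  | true  | _ = refl
  ... | true  | false | _ = refl
  ... | false | true  | h = case h refl of λ ()
  ... | false | false | _ = refl

card-⊍ : ∀ {n} (S T : Subset n) → (∀ p → lookup T p ≡ true → lookup S p ≡ false) → card (S ⊍ T) ≡ card S + card T
card-⊍ S T disjoint = trans
  (sum-cong-≗ (λ p → trans (cong bit (lookup-⊍ S T p)) (pointwise p)))
  (∑-distrib-+ (bit ∘ lookup S) (bit ∘ lookup T))
  where
  pointwise : ∀ p → bit (lookup S p ∨ lookup T p) ≡ bit (lookup S p) + bit (lookup T p)
  pointwise p with lookup S p | lookup T p | disjoint p
  ... | true  | true  | h = case h refl of λ ()
  ... | true  | false | _ = refl
  ... | false | _     | _ = refl

bool-ext : ∀ {b c} → (b ≡ true → c ≡ true) → (c ≡ true → b ≡ true) → b ≡ c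
bool-ext {true}  {c}     f g = sym (f refl)
bool-ext {false} {false} f g = refl
bool-ext {false} {true}  f g = g refl

least : {P : ℕ → Set} → (∀ m → Dec (P m)) → ∀ m → P m → ∃[ l ] (P l × (∀ j → j < l → ¬ P j))
least P? zero    p = zero , p , λ _ ()
least P? (suc m) p with P? 0
... | yes p₀ = zero , p₀ , λ _ ()
... | no ¬p₀ = let l , pl , min = least (P? ∘ suc) m p
               in suc l , pl , λ { zero _ → ¬p₀ ; (suc j) (s≤s j<l) → min j j<l }

module Cycles {n} (x : Perm n) where

  Fixed : Subset n → Set
  Fixed T = Maps x T T

  iter-+ : ∀ a b p → iter x (a + b) p ≡ iter x a (iter x b p)
  iter-+ zero    b p = refl
  iter-+ (suc a) b p = cong (x ⟨$⟩ʳ_) (iter-+ a b p)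

  x-injective : ∀ {p q} → x ⟨$⟩ʳ p ≡ x ⟨$⟩ʳ q → p ≡ q
  x-injective eq = trans (sym (inverseˡ x)) (trans (cong (x ⟨$⟩ˡ_) eq) (inverseˡ x))

  iter-injective : ∀ m {p q} → iter x m p ≡ iter x m q → p ≡ q
  iter-injective zero    eq = eq
  iter-injective (suc m) eq = iter-injective m (x-injective eq)

  iter-∸ : ∀ {s t} p → s ≤ t → iter x s p ≡ iter x t p → iter x (t ∸ s) p ≡ p
  iter-∸ {s} {t} p s≤t eq = sym (iter-injective s (trans eq
    (trans (cong (λ u → iter x u p) (sym (m+[n∸m]≡n s≤t))) (iter-+ s (t ∸ s) p))))

  fixed-iter : ∀ {T} → Fixed T → ∀ m p → lookup T (iter x m p) ≡ lookup T p
  fixed-iter fix zero    p = refl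
  fixed-iter fix (suc m) p = trans (at fix _) (fixed-iter fix m p)

  abstract
    -- Two of the n + 1 iterates with exponents 0, ..., n coincide, and cancelling the smaller power
    -- gives a return to `p`. Abstract, because later types such as `Fin (proj₁ (orbitLen p))`
    -- should not unfold this search.
    orbitLen : ∀ p → ∃[ l ] OrbitLen x p l
    orbitLen p =
      let i , j , i<j , eq = Finₚ.pigeonhole (n<1+n n) (λ (t : Fin (suc n)) → iter x (toℕ t) p)
          -- One less than the return time: the search runs over `suc m`, which keeps the length
          -- positive.
          d = toℕ j ∸ suc (toℕ i)
          return = trans (cong (λ u → iter x u p) (sym (+-∸-assoc 1 i<j))) (iter-∸ p (<⇒≤ i<j) eq)
          l , pl , min = least (λ m → iter x (suc m) p Finₚ.≟ p) d return
      in suc l , s≤s z≤n , pl , λ { (suc m) _ (s≤s m<l) → min m m<l }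

  orbitLen-unique : ∀ {p l l′} → OrbitLen x p l → OrbitLen x p l′ → l ≡ l′
  orbitLen-unique {l = l} {l′} (1≤l , eq , min) (1≤l′ , eq′ , min′) = ≤-antisym
    (≮⇒≥ (λ l′<l → min l′ 1≤l′ l′<l eq′)) (≮⇒≥ (λ l<l′ → min′ l 1≤l l<l′ eq))

  iter-distinct : ∀ {p l} → OrbitLen x p l → ∀ s t → s < l → t < l → iter x s p ≡ iter x t p → s ≡ t
  iter-distinct {p} {l} (_ , _ , min) s t s<l t<l eq = ≤-antisym
    (≮⇒≥ (λ t<s → min (s ∸ t) (m<n⇒0<n∸m t<s) (≤-<-trans (m∸n≤m s t) s<l) (iter-∸ p (<⇒≤ t<s) (sym eq))))
    (≮⇒≥ (λ s<t → min (t ∸ s) (m<n⇒0<n∸m s<t) (≤-<-trans (m∸n≤m t s) t<l) (iter-∸ p (<⇒≤ s<t) eq)))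

  -- The bound on the exponent makes membership decidable, and by `iter-distinct` it lists every
  -- point of the cycle once, as `len-orbitLen` requires. `iter-visits` lifts the bound.
  visits? : ∀ p q → Dec (∃[ t ] iter x (toℕ {proj₁ (orbitLen p)} t) p ≡ q)
  visits? p q = Finₚ.any? (λ t → iter x (toℕ t) p Finₚ.≟ q)

  orbit : Fin n → Subset n
  orbit p = tabulate (λ q → does (visits? p q))

  orbit⇒visits : ∀ {p q} → lookup (orbit p) q ≡ true → ∃[ t ] iter x (toℕ {proj₁ (orbitLen p)} t) p ≡ q
  orbit⇒visits {p} {q} q∈ = does-true⇒ (visits? p q) (trans (sym (Vecₚ.lookup∘tabulate _ q)) q∈)

  visits⇒orbit : ∀ {p q} → ∃[ t ] iter x (toℕ {proj₁ (orbitLen p)} t) p ≡ q → lookup (orbit p) q ≡ true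
  visits⇒orbit {p} {q} v = trans (Vecₚ.lookup∘tabulate _ q) (dec-true (visits? p q) v)

  iter-visits : ∀ p m → ∃[ t ] iter x (toℕ {proj₁ (orbitLen p)} t) p ≡ iter x m p
  iter-visits p zero = fromℕ< 1≤l , cong (λ u → iter x u p) (Finₚ.toℕ-fromℕ< 1≤l)
    where 1≤l = proj₁ (proj₂ (orbitLen p))
  iter-visits p (suc m) with iter-visits p m
  ... | t , eq with m≤n⇒m<n∨m≡n (Finₚ.toℕ<n t)
  ...   | inj₁ st<l = fromℕ< st<l , trans (cong (λ u → iter x u p) (Finₚ.toℕ-fromℕ< st<l)) (cong (x ⟨$⟩ʳ_) eq)
  ...   | inj₂ st≡l = let t₀ , eq₀ = iter-visits p zero in t₀ , trans eq₀
            (trans (sym (proj₁ (proj₂ (proj₂ (orbitLen p)))))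
              (trans (cong (λ u → iter x u p) (sym st≡l)) (cong (x ⟨$⟩ʳ_) eq)))

  iter∈orbit : ∀ p m → lookup (orbit p) (iter x m p) ≡ true
  iter∈orbit p m = visits⇒orbit (iter-visits p m)

  ∈orbit-self : ∀ p → lookup (orbit p) p ≡ true
  ∈orbit-self p = iter∈orbit p 0

  orbit-fixed : ∀ p → Fixed (orbit p)
  orbit-fixed p = mk λ q → bool-ext (backward q) (forward q)
    where
    forward : ∀ q → lookup (orbit p) q ≡ true → lookup (orbit p) (x ⟨$⟩ʳ q) ≡ true
    forward q q∈ = let t , eq = orbit⇒visits q∈ in
      subst (λ r → lookup (orbit p) (x ⟨$⟩ʳ r) ≡ true) eq (iter∈orbit p (suc (toℕ t)))
    -- On a cycle of length l + 1, going back one step is the same as going forward l steps.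
    predecessor : ∀ {l q} → OrbitLen x p l → ∀ m → iter x m p ≡ x ⟨$⟩ʳ q → ∃[ m′ ] iter x m′ p ≡ q
    predecessor {suc l} (_ , return , _) m eq = m + l , x-injective
      (trans (cong (λ u → iter x u p) (sym (+-suc m l))) (trans (iter-+ m (suc l) p) (trans (cong (iter x m) return) eq)))
    backward : ∀ q → lookup (orbit p) (x ⟨$⟩ʳ q) ≡ true → lookup (orbit p) q ≡ true
    backward q xq∈ =
      let t , eq = orbit⇒visits xq∈
          m , eq′ = predecessor (proj₂ (orbitLen p)) (toℕ t) eq
      in subst (λ r → lookup (orbit p) r ≡ true) eq′ (iter∈orbit p m)

  orbit-⊆ : ∀ {T p} → Fixed T → lookup T p ≡ true → ∀ q → lookup (orbit p) q ≡ true → lookup T q ≡ true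
  orbit-⊆ {T} {p} fix p∈T q q∈ = let t , eq = orbit⇒visits q∈ in
    trans (cong (lookup T) (sym eq)) (trans (fixed-iter fix (toℕ t) p) p∈T)

  orbit-sym : ∀ {p q} → lookup (orbit p) q ≡ true → lookup (orbit q) p ≡ true
  orbit-sym {p} {q} q∈ = let t , eq = orbit⇒visits q∈ in
    trans (sym (fixed-iter (orbit-fixed q) (toℕ t) p)) (trans (cong (lookup (orbit q)) eq) (∈orbit-self q))

  orbit-≡ : ∀ {p q} → lookup (orbit p) q ≡ true → orbit q ≡ orbit p
  orbit-≡ {p} {q} q∈ = subset-ext λ r →
    bool-ext (orbit-⊆ (orbit-fixed p) q∈ r) (orbit-⊆ (orbit-fixed q) (orbit-sym q∈) r)

  len : Fin n → ℕ
  len p = card (orbit p)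

  len-orbitLen : ∀ p → len p ≡ proj₁ (orbitLen p)
  len-orbitLen p = HasCard-unique trans sym (HasCard-card (orbit p))
    ( (λ t → iter x (toℕ t) p)
    , (λ t → iter∈orbit p (toℕ t))
    , (λ s t eq → Finₚ.toℕ-injective (iter-distinct (proj₂ (orbitLen p)) (toℕ s) (toℕ t) (Finₚ.toℕ<n s) (Finₚ.toℕ<n t) eq))
    , (λ q q∈ → let t , eq = orbit⇒visits q∈ in t , sym eq))

  orbitLen⇒len : ∀ {p l} → OrbitLen x p l → l ≡ len p
  orbitLen⇒len {p} o = trans (orbitLen-unique o (proj₂ (orbitLen p))) (sym (len-orbitLen p))

  len⇒orbitLen : ∀ {p l} → len p ≡ l → OrbitLen x p l
  len⇒orbitLen {p} eq = subst (OrbitLen x p) (trans (sym (len-orbitLen p)) eq) (proj₂ (orbitLen p))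

  len-≤ : ∀ {T p} → Fixed T → lookup T p ≡ true → len p ≤ card T
  len-≤ {T} {p} fix p∈T = card-mono {S = orbit p} {T} (orbit-⊆ fix p∈T)

  cycleRep : ∀ p → ∃[ r ] (CycleRep x r × lookup (orbit p) r ≡ true)
  cycleRep p =
    let m , (r , r≡m , r∈) , min = least
          (λ m → Finₚ.any? (λ q → (toℕ q ≟ m) ×-dec (lookup (orbit p) q Boolₚ.≟ true)))
          (toℕ p) (p , refl , ∈orbit-self p)
    in r
     , (λ t → ≮⇒≥ (λ lt → min (toℕ (iter x t r)) (subst (toℕ (iter x t r) <_) r≡m lt)
         (iter x t r , refl , trans (fixed-iter (orbit-fixed p) t r) r∈)))
     , r∈

  cycleRep-unique : ∀ {r s} → CycleRep x r → CycleRep x s → lookup (orbit r) s ≡ true → r ≡ s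
  cycleRep-unique {r} {s} r-min s-min s∈ =
    let t , r→s = orbit⇒visits s∈
        u , s→r = orbit⇒visits (orbit-sym s∈)
    in Finₚ.toℕ-injective (≤-antisym
         (subst (λ q → toℕ r ≤ toℕ q) r→s (r-min (toℕ t)))
         (subst (λ q → toℕ s ≤ toℕ q) s→r (s-min (toℕ u))))

  -- The same count as `HasCard _≡_ (CycleOfLen x l) 1`, but phrased through arbitrary points of
  -- cycles, so that least representatives can be forgotten.
  OneCycle : ℕ → Set
  OneCycle l = (∃[ c ] len c ≡ l) × (∀ p q → len p ≡ l → len q ≡ l → lookup (orbit p) q ≡ true)

  oneCycle⇒card : ∀ {l} → OneCycle l → HasCard _≡_ (CycleOfLen x l) 1
  oneCycle⇒card {l} ((c , len-c) , one) =
    (λ _ → r) ,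
    (λ _ → r-min , len⇒orbitLen len-r) ,
    (λ { zero zero _ → refl }) ,
    (λ s (s-min , s-len) → zero , sym (cycleRep-unique r-min s-min (one r s len-r (sym (orbitLen⇒len s-len)))))
    where
    r = proj₁ (cycleRep c)
    r-min = proj₁ (proj₂ (cycleRep c))
    len-r : len r ≡ l
    len-r = trans (cong card (orbit-≡ (proj₂ (proj₂ (cycleRep c))))) len-c

  card⇒oneCycle : ∀ {l} → HasCard _≡_ (CycleOfLen x l) 1 → OneCycle l
  card⇒oneCycle {l} (f , fP , _ , sur) = (f zero , sym (orbitLen⇒len (proj₂ (fP zero)))) , one
    where
    rep≡ : ∀ p → len p ≡ l → orbit (f zero) ≡ orbit p
    rep≡ p len-p with cycleRep p
    ... | r , r-min , r∈ with sur r (r-min , len⇒orbitLen (trans (cong card (orbit-≡ r∈)) len-p))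
    ...   | zero , eq = trans (cong orbit (sym eq)) (orbit-≡ r∈)
    one : ∀ p q → len p ≡ l → len q ≡ l → lookup (orbit p) q ≡ true
    one p q len-p len-q = trans (cong (λ O → lookup O q) (trans (sym (rep≡ p len-p)) (rep≡ q len-q))) (∈orbit-self q)

  -- Unions of cycles of two-power lengths, and binary expansions

  Small : ℕ → Subset n → Set
  Small a S = Fixed S × (∀ p → lookup S p ≡ true → ∃[ i ] (i < a × len p ≡ 2 ^ i))

  fixed-∖ : ∀ {S T} → Fixed S → Fixed T → Fixed (S ∖ T)
  fixed-∖ {S} {T} fS fT = mk λ p → trans (lookup-∖ S T _)
    (trans (cong₂ (λ s t → s ∧ not t) (at fS p) (at fT p)) (sym (lookup-∖ S T p)))

  fixed-⊍ : ∀ {S T} → Fixed S → Fixed T → Fixed (S ⊍ T)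
  fixed-⊍ {S} {T} fS fT = mk λ p → trans (lookup-⊍ S T _)
    (trans (cong₂ _∨_ (at fS p) (at fT p)) (sym (lookup-⊍ S T p)))

  2^-injective : ∀ {i j} → 2 ^ i ≡ 2 ^ j → i ≡ j
  2^-injective {i} {j} eq = ≤-antisym
    (≮⇒≥ (λ j<i → <⇒≢ (^-monoʳ-< 2 (s≤s (s≤s z≤n)) j<i) (sym eq)))
    (≮⇒≥ (λ i<j → <⇒≢ (^-monoʳ-< 2 (s≤s (s≤s z≤n)) i<j) eq))

  -- The cycle through `c` plays the leading binary digit: a set that is `Small (suc a)` either
  -- contains it entirely or is already `Small a`.
  module Split a (one : OneCycle (2 ^ a)) where

    c = proj₁ (proj₁ one)
    len-c = proj₂ (proj₁ one)

    small-without : ∀ {S} → Small (suc a) S → lookup S c ≡ false → Small a S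
    small-without {S} (fix , pow) c∉S = fix , pow′
      where
      pow′ : ∀ p → lookup S p ≡ true → ∃[ i ] (i < a × len p ≡ 2 ^ i)
      pow′ p p∈S with pow p p∈S
      ... | i , s≤s i≤a , len-p with m≤n⇒m<n∨m≡n i≤a
      ...   | inj₁ i<a  = i , i<a , len-p
      -- A point of `S` on a cycle of length `2 ^ a` shares that cycle with `c`, so the fixed set
      -- `S` would contain `c`.
      ...   | inj₂ refl = case trans (sym c∉S) (orbit-⊆ fix p∈S c (proj₂ one p c len-p len-c)) of λ ()

    small-remove : ∀ {S} → Small (suc a) S → Small a (S ∖ orbit c)
    small-remove {S} (fix , pow) = small-without (fixed-∖ fix (orbit-fixed c) ,
      (λ p p∈ → pow p (∧-left (trans (sym (lookup-∖ S (orbit c) p)) p∈))))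
      (trans (lookup-∖ S (orbit c) c) (trans (cong (λ b → lookup S c ∧ not b) (∈orbit-self c)) (Boolₚ.∧-zeroʳ (lookup S c))))
      where
      ∧-left : ∀ {b d} → b ∧ d ≡ true → b ≡ true
      ∧-left {true} _ = refl

    card-remove-orbit : ∀ {S} → Fixed S → lookup S c ≡ true → card (S ∖ orbit c) + 2 ^ a ≡ card S
    card-remove-orbit {S} fix c∈S = trans (cong (card (S ∖ orbit c) +_) (sym len-c)) (card-∖ S (orbit c) (orbit-⊆ fix c∈S))

    small-add : ∀ {S} → Small a S → Small (suc a) (S ⊍ orbit c)
    small-add {S} (fix , pow) = fixed-⊍ fix (orbit-fixed c) , λ p p∈ →
      [ (λ p∈S → let i , i<a , eq = pow p p∈S in i , m≤n⇒m≤1+n i<a , eq)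
      , (λ p∈c → a , n<1+n a , trans (cong card (orbit-≡ p∈c)) len-c)
      ]′ (∨-cases (trans (sym (lookup-⊍ S (orbit c) p)) p∈))
      where
      ∨-cases : ∀ {b d} → b ∨ d ≡ true → b ≡ true ⊎ d ≡ true
      ∨-cases {true}  _  = inj₁ refl
      ∨-cases {false} eq = inj₂ eq

    card-add : ∀ {S} → Small a S → card (S ⊍ orbit c) ≡ card S + 2 ^ a
    card-add {S} (_ , pow) = trans (card-⊍ S (orbit c) disjoint) (cong (card S +_) len-c)
      where
      disjoint : ∀ p → lookup (orbit c) p ≡ true → lookup S p ≡ false
      disjoint p p∈c = Boolₚ.¬-not (λ p∈S → let i , i<a , eq = pow p p∈S in
        <⇒≢ i<a (2^-injective (trans (sym eq) (trans (cong card (orbit-≡ p∈c)) len-c))))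

    c∈add : ∀ S → lookup (S ⊍ orbit c) c ≡ true
    c∈add S = trans (lookup-⊍ S (orbit c) c) (trans (cong (lookup S c ∨_) (∈orbit-self c)) (Boolₚ.∨-zeroʳ (lookup S c)))

    restore : ∀ {S T} → Fixed S → Fixed T → lookup S c ≡ true → lookup T c ≡ true →
      S ∖ orbit c ≡ T ∖ orbit c → S ≡ T
    restore {S} {T} fS fT c∈S c∈T eq = subset-ext pointwise
      where
      pointwise : ∀ p → lookup S p ≡ lookup T p
      pointwise p with lookup (orbit c) p in p∈c
      ... | true  = trans (orbit-⊆ fS c∈S p p∈c) (sym (orbit-⊆ fT c∈T p p∈c))
      ... | false = trans (sym (keep S)) (trans (cong (λ U → lookup U p) eq) (keep T))
        where
        keep : ∀ U → lookup (U ∖ orbit c) p ≡ lookup U p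
        keep U = trans (lookup-∖ U (orbit c) p) (trans (cong (λ b → lookup U p ∧ not b) p∈c) (Boolₚ.∧-identityʳ (lookup U p)))

  2^suc : ∀ a → 2 ^ suc a ≡ 2 ^ a + 2 ^ a
  2^suc a = cong (2 ^ a +_) (+-identityʳ (2 ^ a))

  Powers : ℕ → Set
  Powers a = ∀ i → i < a → OneCycle (2 ^ i)

  powers-pred : ∀ {a} → Powers (suc a) → Powers a
  powers-pred h i i<a = h i (m≤n⇒m≤1+n i<a)

  small-zero : ∀ {S} → Small 0 S → ∀ p → lookup S p ≡ false
  small-zero (_ , pow) p = Boolₚ.¬-not (λ p∈S → case proj₁ (proj₂ (pow p p∈S)) of λ ())

  -- A union of distinct cycles of lengths 1, 2, …, 2 ^ (a − 1) is determined by the binary digits of its size.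
  small-bound : ∀ a → Powers a → ∀ {S} → Small a S → card S < 2 ^ a
  small-bound zero _ {S} small = ≤-reflexive (cong suc (sum-zero (bit ∘ lookup S) (λ p → cong bit (small-zero {S} small p))))
  small-bound (suc a) h {S} small = subst (card S <_) (sym (2^suc a)) (bound (lookup S c) refl)
    where
    open Split a (h a (n<1+n a))
    bound : ∀ b → lookup S c ≡ b → card S < 2 ^ a + 2 ^ a
    bound true  c∈S = subst (_< 2 ^ a + 2 ^ a) (card-remove-orbit (proj₁ small) c∈S)
      (+-monoˡ-< (2 ^ a) (small-bound a (powers-pred h) (small-remove small)))
    bound false c∉S = ≤-trans (small-bound a (powers-pred h) (small-without small c∉S)) (m≤m+n _ _)

  -- The size reveals the leading digit: it is at least `2 ^ a` if the set contains `c`, and below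
  -- `2 ^ a` by `small-bound` if not. So equal sizes agree on `c`, and the remaining digits follow
  -- by induction.
  small-unique : ∀ a → Powers a → ∀ {S T} → Small a S → Small a T → card S ≡ card T → S ≡ T
  small-unique zero _ {S} {T} sS sT _ = subset-ext (λ p → trans (small-zero {S} sS p) (sym (small-zero {T} sT p)))
  small-unique (suc a) h {S} {T} sS sT eq = unique (lookup S c) (lookup T c) refl refl
    where
    open Split a (h a (n<1+n a))
    h′ = powers-pred h
    2^a≤ : ∀ {U} → Fixed U → lookup U c ≡ true → 2 ^ a ≤ card U
    2^a≤ {U} fix c∈U = ≤-trans (m≤n+m (2 ^ a) (card (U ∖ orbit c))) (≤-reflexive (card-remove-orbit fix c∈U))
    unique : ∀ b d → lookup S c ≡ b → lookup T c ≡ d → S ≡ T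
    unique true true c∈S c∈T = restore (proj₁ sS) (proj₁ sT) c∈S c∈T
      (small-unique a h′ (small-remove sS) (small-remove sT) (+-cancelʳ-≡ (2 ^ a) _ _
        (trans (card-remove-orbit (proj₁ sS) c∈S) (trans eq (sym (card-remove-orbit (proj₁ sT) c∈T))))))
    unique true false c∈S c∉T = contradiction
      (≤-trans (2^a≤ (proj₁ sS) c∈S) (≤-reflexive eq)) (<⇒≱ (small-bound a h′ (small-without sT c∉T)))
    unique false true c∉S c∈T = contradiction
      (≤-trans (2^a≤ (proj₁ sT) c∈T) (≤-reflexive (sym eq))) (<⇒≱ (small-bound a h′ (small-without sS c∉S)))
    unique false false c∉S c∉T = small-unique a h′ (small-without sS c∉S) (small-without sT c∉T) eq

  small-exists : ∀ a → Powers a → ∀ m → m < 2 ^ a → ∃[ S ] (Small a S × card S ≡ m)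
  small-exists zero _ zero _ = ∅ , (mk (λ p → trans (empty _) (sym (empty p))) , λ p p∈ → case trans (sym (empty p)) p∈ of λ ()) ,
    sum-zero (bit ∘ lookup ∅) (λ p → cong bit (empty p))
    where
    ∅ = tabulate {n = n} (λ _ → false)
    empty : ∀ p → lookup ∅ p ≡ false
    empty p = Vecₚ.lookup∘tabulate _ p
  small-exists zero _ (suc m) (s≤s ())
  small-exists (suc a) h m m<2^a with m <? 2 ^ a
  ... | yes m<2^a′ =
    let S , (fix , pow) , cS = small-exists a (powers-pred h) m m<2^a′
    in S , (fix , λ p p∈S → let i , i<a , eq = pow p p∈S in i , m≤n⇒m≤1+n i<a , eq) , cS
  ... | no m≮2^a =
    let 2^a≤m = ≮⇒≥ m≮2^a
        S , small , cS = small-exists a (powers-pred h) (m ∸ 2 ^ a)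
          (+-cancelʳ-< (2 ^ a) _ _ (subst₂ _<_ (sym (m∸n+n≡m 2^a≤m)) (2^suc a) m<2^a))
    in S ⊍ orbit c , small-add small , trans (card-add small) (trans (cong (_+ 2 ^ a) cS) (m∸n+n≡m 2^a≤m))
    where open Split a (h a (n<1+n a))

  -- Uniqueness of fixed sets and the cycle type

  UniqueFixed : ℕ → Set
  UniqueFixed i = ∃[ T ] ((card T ≡ i × Fixed T) × (∀ S → card S ≡ i × Fixed S → S ≡ T))

  fixedCount-card : ∀ i → HasCard _≡_ (λ T → card T ≡ i × Fixed T) (fixedCount i x)
  fixedCount-card i = Subsets.HasCard-total (λ T → (card T ≟ i) ×-dec maps? x T T) (λ { refl cf → cf })

  count⇒unique : ∀ {i} → fixedCount i x ≡ 1 → UniqueFixed i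
  count⇒unique {i} one with subst (HasCard _≡_ _) one (fixedCount-card i)
  ... | f , fP , _ , sur = f zero , fP zero , λ S s → only (sur S s)
    where
    only : ∀ {S} → ∃[ t ] (S ≡ f t) → S ≡ f zero
    only (zero , eq) = eq

  unique⇒count : ∀ {i} → UniqueFixed i → fixedCount i x ≡ 1
  unique⇒count {i} (T , t , uniq) = HasCard-unique trans sym (fixedCount-card i)
    ((λ _ → T) , (λ _ → t) , (λ { zero zero _ → refl }) , (λ S s → zero , uniq S s))

  module _ {k j : ℕ} (2^j≤k : 2 ^ j ≤ k) (k<2^1+j : k < 2 ^ suc j) where

    -- A fixed set with at most `k` points contains no cycle longer than `k`, so it is
    -- `Small (suc j)`. As k < 2^(j+1), the available digits suffice for every size up to `k`.
    condition⇒unique : CycleCondition k j x → ∀ i → i ≤ k → UniqueFixed i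
    condition⇒unique (powers , others) i i≤k =
      let T , small , cT = small-exists (suc j) h i (≤-<-trans i≤k k<2^1+j)
      in T , (cT , proj₁ small) , λ S (cS , fS) →
           small-unique (suc j) h (fS , fixed-small S cS fS) small (trans cS (sym cT))
      where
      h : Powers (suc j)
      h i (s≤s i≤j) = card⇒oneCycle (powers i i≤j)
      short : ∀ p → len p ≤ k → ∃[ i ] (i < suc j × len p ≡ 2 ^ i)
      short p len≤k with cycleRep p
      ... | r , r-min , r∈ with others r (len p) (r-min , len⇒orbitLen (cong card (orbit-≡ r∈)))
      ...   | inj₁ (i , i≤j , eq) = i , s≤s i≤j , eq
      ...   | inj₂ k<len = contradiction len≤k (<⇒≱ k<len)
      fixed-small : ∀ S → card S ≡ i → Fixed S → ∀ p → lookup S p ≡ true → ∃[ i ] (i < suc j × len p ≡ 2 ^ i)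
      fixed-small S cS fS p p∈S = short p (≤-trans (len-≤ fS p∈S) (≤-trans (≤-reflexive cS) i≤k))

    module _ (unique : ∀ i → i ≤ k → UniqueFixed i) where

      same-set : ∀ {i S T} → i ≤ k → card S ≡ i → card T ≡ i → Fixed S → Fixed T → S ≡ T
      same-set i≤k cS cT fS fT = let _ , _ , uniq = unique _ i≤k in
        trans (uniq _ (cS , fS)) (sym (uniq _ (cT , fT)))

      -- The bound by `k` is needed since uniqueness is known only up to size `k`; for a = j + 1,
      -- lengths between k + 1 and `2 ^ a` remain unrestricted.
      Short : ℕ → Set
      Short a = ∀ p → len p < 2 ^ a → len p ≤ k → ∃[ i ] (i < a × len p ≡ 2 ^ i)

      -- If every cycle in the fixed set `T` of size `2 ^ a` were shorter than `2 ^ a`, then `T`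
      -- would be `Small a` and too small by `small-bound`. So one cycle fills `T`. Two cycles of
      -- this length are fixed sets of equal size, hence coincide.
      next-cycle : ∀ {a} → a ≤ j → Powers a → Short a → OneCycle (2 ^ a)
      next-cycle {a} a≤j h short = found (Finₚ.any? (λ p → (lookup T p Boolₚ.≟ true) ×-dec (2 ^ a ≤? len p))) ,
        λ p q len-p len-q → trans (cong (λ O → lookup O q)
          (same-set 2^a≤k len-p len-q (orbit-fixed p) (orbit-fixed q))) (∈orbit-self q)
        where
        2^a≤k : 2 ^ a ≤ k
        2^a≤k = ≤-trans (^-monoʳ-≤ 2 a≤j) 2^j≤k
        T = proj₁ (unique (2 ^ a) 2^a≤k)
        cT = proj₁ (proj₁ (proj₂ (unique (2 ^ a) 2^a≤k)))
        fT = proj₂ (proj₁ (proj₂ (unique (2 ^ a) 2^a≤k)))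
        len≤ : ∀ p → lookup T p ≡ true → len p ≤ 2 ^ a
        len≤ p p∈T = ≤-trans (len-≤ fT p∈T) (≤-reflexive cT)
        found : Dec (∃[ p ] (lookup T p ≡ true × 2 ^ a ≤ len p)) → ∃[ p ] len p ≡ 2 ^ a
        found (yes (p , p∈T , 2^a≤len)) = p , ≤-antisym (len≤ p p∈T) 2^a≤len
        found (no none) = contradiction cT (<⇒≢ (small-bound a h
          (fT , λ p p∈T → short p (≰⇒> (λ 2^a≤len → none (p , p∈T , 2^a≤len))) (≤-trans (len≤ p p∈T) 2^a≤k))))

      -- A cycle with length from `2 ^ a` to below `2 ^ suc a` has a competitor of the same size,
      -- assembled from the cycles of two-power lengths according to the binary digits of `len p`.
      -- Uniqueness makes them equal, so the cycle contains `c` and is the one of length `2 ^ a`.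
      next-short : ∀ {a} → Powers a → OneCycle (2 ^ a) → Short a → Short (suc a)
      next-short {a} h one short p len< len≤k with len p <? 2 ^ a
      ... | yes len<2^a = let i , i<a , eq = short p len<2^a len≤k in i , m≤n⇒m≤1+n i<a , eq
      ... | no len≮2^a = a , n<1+n a , trans (cong card (sym (orbit-≡ c∈p))) len-c
        where
        open Split a one
        2^a≤len = ≮⇒≥ len≮2^a
        rest = small-exists a h (len p ∸ 2 ^ a)
          (+-cancelʳ-< (2 ^ a) _ _ (subst₂ _<_ (sym (m∸n+n≡m 2^a≤len)) (2^suc a) len<))
        S = proj₁ rest
        small = proj₁ (proj₂ rest)
        -- The union of S and the cycle of length 2 ^ a has the size of the orbit of p, hence equals it.
        c∈p : lookup (orbit p) c ≡ true
        c∈p = trans (cong (λ O → lookup O c) (same-set len≤k refl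
            (trans (card-add small) (trans (cong (_+ 2 ^ a) (proj₂ (proj₂ rest))) (m∸n+n≡m 2^a≤len)))
            (orbit-fixed p) (fixed-⊍ (proj₁ small) (orbit-fixed c)))) (c∈add S)

      -- The two statements must be proved together: `next-cycle` needs both for `a`, and
      -- `next-short` needs the cycle just found.
      powers-short : ∀ a → a ≤ suc j → Powers a × Short a
      powers-short zero _ = (λ _ ()) , λ p len<1 _ → contradiction (proj₁ (len⇒orbitLen {p} refl)) (<⇒≱ len<1)
      powers-short (suc a) (s≤s a≤j) =
        let h , short = powers-short a (m≤n⇒m≤1+n a≤j)
            one = next-cycle a≤j h short
        in (λ { i (s≤s i≤a) → [ (λ i<a → h i i<a) , (λ { refl → one }) ]′ (m≤n⇒m<n∨m≡n i≤a) })
           , next-short h one short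

      unique⇒condition : CycleCondition k j x
      unique⇒condition =
        let h , short = powers-short (suc j) ≤-refl
        in (λ i i≤j → oneCycle⇒card (h i (s≤s i≤j))) , λ p l (_ , o) → lengths p l (orbitLen⇒len o) short
        where
        lengths : ∀ p l → l ≡ len p → Short (suc j) → (∃[ i ] (i ≤ j × l ≡ 2 ^ i)) ⊎ suc k ≤ l
        lengths p l refl short with len p ≤? k
        ... | yes len≤k = let i , i<1+j , eq = short p (≤-<-trans len≤k k<2^1+j) len≤k in inj₁ (i , ≤-pred i<1+j , eq)
        ... | no len≰k  = inj₂ (≰⇒> len≰k)

theorem1p1 : (n k j : ℕ) → 1 ≤ k → 2 * k < n → 2 ^ j ≤ k → k < 2 ^ suc j →
    (x : Perm n) →
    (∃[ r ] (1 ≤ r × IsCode r (ConjClass x) (Young k))) ⇔ CycleCondition k j x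
theorem1p1 n k j _ 2k<n 2^j≤k k<2^1+j x = mk⇔
  (λ (_ , _ , code) → unique⇒condition 2^j≤k k<2^1+j (λ i i≤k → count⇒unique (code⇒fixed k+k<n code i i≤k)))
  (λ condition → fixed⇒code k+k<n (λ i i≤k → unique⇒count (condition⇒unique 2^j≤k k<2^1+j condition i i≤k)))
  where
  open Code x
  open Cycles x
  k+k<n : k + k < n
  k+k<n = subst (_< n) (cong (k +_) (+-identityʳ k)) 2k<n
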